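{- Let $n\ge 1$ and let $\sigma,\tau\in S^B_n$. Let $J(\sigma,\tau)\in S^B_n$ be the signed permutation produced from $\sigma$ and $\tau$ by the algorithm described in the context. Then $$J(\sigma,\tau)=\sigma\vee_R\tau,$$ where $\sigma\vee_R\tau$ denotes the join of $\sigma$ and $\tau$ in the (right) weak order $(S^B_n,\leq_R)$.
   Context: **Signed permutations.** Write $[n]=\{1,\ldots,n\}$, $[\pm n]=\{ -n,\ldots,-1,1,\ldots,n\}$ and $\overline{i}=-i$. $S^B_n$ is the group (under composition of maps) of bijections $\sigma:[\pm n]\to[\pm n]$ with $\sigma(-a)=-\sigma(a)$ for all $a\in[n]$. It is a Coxeter group of type $B_n$ with Coxeter generators $s_0,s_1,\ldots,s_{n-1}$, where $s_0$ exchanges $1$ and $\overline 1$ (fixing everything else) and, for $1\le i\le n-1$, $s_i$ exchanges $i$ with $i+1$ and $\overline{i}$ with $\overline{i+1}$ (fixing everything else). The complete notation of $\sigma$ is the string $\sigma(\overline n)\cdots\sigma(\overline 1)\sigma(1)\cdots\sigma(n)$ of length $2n$. **Weak order.** Let $\ell$ be the Coxeter length. For $u,v\in S^B_n$, $u\leq_R v$ if and only if some reduced expression for $u$ is a prefix of a reduced expression for $v$ (equivalently, $v=uw$ for some $w$ with $\ell(v)=\ell(u)+\ell(w)$). Since the group is finite, $(S^B_n,\leq_R)$ is a lattice. **Algorithm.** For $\sigma\in S^B_n$ and $2\le i\le n$ define $$H^\sigma_i=\{a\in[\pm(i-1)]\mid \sigma^{ -1}(a)>\sigma^{ -1}(i)\}.$$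 Given $\sigma,\tau\in S^B_n$, define signed permutations $\pi_i\in S^B_i$ for $i=1,\ldots,n$, always written in complete notation (as strings of length $2i$), as follows. 1. $\pi_1=\overline{1}\,1$ if $\sigma^{ -1}(1)>0$ and $\tau^{ -1}(1)>0$; otherwise $\pi_1=1\,\overline{1}$. 2. For each $i=2,3,\ldots,n$: let $C^*_{i-1}$ be the shortest (possibly empty) suffix of the string $\pi_{i-1}$ whose set of entries contains $H^\sigma_i\cup H^\tau_i$, and let $C_{i-1}$ be the string with $\pi_{i-1}=C_{i-1}C^*_{i-1}$ (concatenation). Denote by $|\cdot|$ the length of a string. Then $\pi_i$ is obtained by inserting $i$ and $\overline{i}$ in $\pi_{i-1}$ as follows: - if $|C^*_{i-1}|\geq i$, then $\pi_i=C_{i-1}\; i\; C^{*'}_{i-1}\;\overline{i}\; C^{*''}_{i-1}$, where $C^*_{i-1}=C^{*'}_{i-1}C^{*''}_{i-1}$ with $|C^{*''}_{i-1}|=|C_{i-1}|$; - if $|C^*_{i-1}|\leq i-2$, then $\pi_i=C'_{i-1}\;\overline{i}\; C''_{i-1}\; i\; C^*_{i-1}$, where $C_{i-1}=C'_{i-1}C''_{i-1}$ with $|C'_{i-1}|=|C^*_{i-1}|$; - if $|C^*_{i-1}|=i-1$ and both $\sigma^{ -1}(i)>0$ and $\tau^{ -1}(i)>0$, then $\pi_i=C_{i-1}\;\overline{i}\; i\; C^*_{i-1}$; - if $|C^*_{i-1}|=i-1$ and at least one of $\sigma^{ -1}(i),\tau^{ -1}(i)$ is negative, then $\pi_i=C_{i-1}\;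 i\;\overline{i}\; C^*_{i-1}$. 3. Set $J(\sigma,\tau):=\pi_n$. -}

module Defs where

open import Data.Fin.Base using (Fin; zero; suc; toℕ; fromℕ<; inject₁)
import Data.Fin.Permutation as Perm
import Data.Fin.Properties as Fin
import Data.Integer.Base as ℤ
open ℤ using (ℤ; _◃_)
import Data.Integer.Properties as ℤ
open import Data.List.Base
  using (List; []; _∷_; _++_; map; filter; foldr; length; reverse; allFin; take; drop)
import Data.List.Relation.Binary.Subset.DecPropositional as DecSubset
open import Data.Nat.Base using (ℕ; suc; _∸_; _≤_)
import Data.Nat.Properties as ℕ
open import Data.Product.Base using (∃₂; _×_; _,_; proj₁; map₁; map₂)
import Data.Product.Properties as Product
import Data.Sign.Base as Sign
open Sign using (Sign; opposite)
import Data.Sign.Properties as Sign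
open import Function.Bundles using (_↔_; Inverse; mk↔ₛ′)
open import Function.Construct.Composition using (_↔-∘_)
open import Function.Construct.Identity using (↔-id)
open import Relation.Binary.Definitions
  using (DecidableEquality; Decidable; tri<; tri≈; tri>)
open import Relation.Binary.PropositionalEquality
  using (_≡_; refl; trans; cong)
open import Relation.Nullary.Decidable using (Dec; yes; no; _×-dec_)

private
  variable
    n : ℕ

-- (s , k) stands for the integer of sign s and absolute value toℕ k + 1.

[±_] : ℕ → Set
[± n ] = Sign × Fin n

pos neg : Fin n → [± n ]
pos k = Sign.+ , k
neg k = Sign.- , k

infix 8 ‾_
‾_ : [± n ] → [± n ]
‾_ = map₁ opposite

∣_∣ : [± n ] → ℕ
∣ _ , k ∣ = suc (toℕ k)

toℤ : [± n ] → ℤ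
toℤ (s , k) = s ◃ suc (toℕ k)

infix 4 _<±_ _<±?_ _≟±_
_<±_ : [± n ] → [± n ] → Set
a <± b = toℤ a ℤ.< toℤ b

_<±?_ : Decidable (_<±_ {n})
a <±? b = toℤ a ℤ.<? toℤ b

Positive : [± n ] → Set
Positive a = ℤ.0ℤ ℤ.< toℤ a

positive? : (a : [± n ]) → Dec (Positive a)
positive? a = ℤ.0ℤ ℤ.<? toℤ a

_≟±_ : DecidableEquality [± n ]
_≟±_ = Product.≡-dec Sign._≟_ Fin._≟_

ascending : (n : ℕ) → List [± n ]
ascending n = map neg (reverse (allFin n)) ++ map pos (allFin n)

record SignedPerm (n : ℕ) : Set where
  field
    bijection : [± n ] ↔ [± n ]

  open Inverse bijection public using (to; from)

  field
    odd : ∀ a → to (‾ a) ≡ ‾ to a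

open SignedPerm public using (to; from)
open SignedPerm using (bijection; odd)

infix 4 _≈_
_≈_ : SignedPerm n → SignedPerm n → Set
σ ≈ τ = ∀ a → to σ a ≡ to τ a

ε : SignedPerm n
ε = record { bijection = ↔-id _ ; odd = λ _ → refl }

infixr 9 _·_
_·_ : SignedPerm n → SignedPerm n → SignedPerm n
σ · τ = record
  { bijection = bijection σ ↔-∘ bijection τ
  ; odd       = λ a → trans (cong (to σ) (odd τ a)) (odd σ (to τ a))
  }

complete : SignedPerm n → List [± n ]
complete {n} σ = map (to σ) (ascending n)

flip₁ : [± suc n ] → [± suc n ]
flip₁ (s , zero)  = opposite s , zero
flip₁ (s , suc k) = s , suc k

flip₁-involutive : (a : [± suc n ]) → flip₁ (flip₁ a) ≡ a
flip₁-involutive (s , zero)  = cong (_, zero) (Sign.opposite-selfInverse refl)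
flip₁-involutive (s , suc k) = refl

flip₁-odd : (a : [± suc n ]) → flip₁ (‾ a) ≡ ‾ flip₁ a
flip₁-odd (s , zero)  = refl
flip₁-odd (s , suc k) = refl

-- suc i : Fin n is the index j = toℕ i + 1 of s_j; the letters of absolute
-- value j and j + 1 have second components inject₁ i and suc i.
s : Fin n → SignedPerm n
s zero = record
  { bijection = mk↔ₛ′ flip₁ flip₁ flip₁-involutive flip₁-involutive
  ; odd       = flip₁-odd
  }
s (suc i) = record
  { bijection = mk↔ₛ′
      (map₂ (t Perm.⟨$⟩ʳ_)) (map₂ (t Perm.⟨$⟩ˡ_))
      (λ a → cong (proj₁ a ,_) (Perm.inverseʳ t))
      (λ a → cong (proj₁ a ,_) (Perm.inverseˡ t))
  ; odd = λ _ → refl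
  }
  where t = Perm.transpose (inject₁ i) (suc i)

Word : ℕ → Set
Word n = List (Fin n)

⟦_⟧ : Word n → SignedPerm n
⟦ w ⟧ = foldr (λ i σ → s i · σ) ε w

ReducedExpression : Word n → SignedPerm n → Set
ReducedExpression w σ =
  ⟦ w ⟧ ≈ σ × (∀ w′ → ⟦ w′ ⟧ ≈ σ → length w ≤ length w′)

infix 4 _≤R_
_≤R_ : SignedPerm n → SignedPerm n → Set
u ≤R v = ∃₂ λ p q → ReducedExpression p u × ReducedExpression (p ++ q) v

IsJoin : SignedPerm n → SignedPerm n → SignedPerm n → Set
IsJoin σ τ ω = σ ≤R ω × τ ≤R ω × (∀ ρ → σ ≤R ρ → τ ≤R ρ → ω ≤R ρ)

-- Strings with entries in [± i ], for any i ≤ n, are lists over [± n ].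

module _ {n : ℕ} where

  open DecSubset (_≟±_ {n}) using (_⊆?_)

  -- The letter of a given k is i = toℕ k + 1.
  H : SignedPerm n → Fin n → List [± n ]
  H σ k = filter
    (λ a → (∣ a ∣ ℕ.<? ∣ pos k ∣) ×-dec (from σ (pos k) <±? from σ a))
    (ascending n)

  -- Splits π as C ++ C*, with C* the shortest suffix containing every
  -- element of hs (provided that π does).
  splitAtSuffix : List [± n ] → List [± n ] → List [± n ] × List [± n ]
  splitAtSuffix hs []       = [] , []
  splitAtSuffix hs (x ∷ xs) with hs ⊆? xs
  ... | yes _ = map₁ (x ∷_) (splitAtSuffix hs xs)
  ... | no  _ = [] , x ∷ xs

  centre : SignedPerm n → SignedPerm n → Fin n → List [± n ]
  centre σ τ k with positive? (from σ (pos k)) ×-dec positive? (from τ (pos k))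
  ... | yes _ = neg k ∷ pos k ∷ []
  ... | no  _ = pos k ∷ neg k ∷ []

  -- With i = toℕ k + 1, the three cases are ∣C*∣ ≤ i - 2, ∣C*∣ = i - 1 and
  -- ∣C*∣ ≥ i.
  insert : SignedPerm n → SignedPerm n → Fin n → List [± n ] → List [± n ]
  insert σ τ k π with splitAtSuffix (H σ k ++ H τ k) π
  ... | C , C* with ℕ.<-cmp (length C*) (toℕ k)
  ...   | tri< _ _ _ = take c C ++ neg k ∷ drop c C ++ pos k ∷ C*
    where c = length C*
  ...   | tri≈ _ _ _ = C ++ centre σ τ k ++ C*
  ...   | tri> _ _ _ = C ++ pos k ∷ take c C* ++ neg k ∷ drop c C*
    where c = length C* ∸ length C

  -- The value at i = 0 is a dummy, which matters only if n = 0.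
  π : SignedPerm n → SignedPerm n → (i : ℕ) → i ≤ n → List [± n ]
  π σ τ 0               _   = []
  π σ τ 1               1≤n = centre σ τ (fromℕ< 1≤n)
  π σ τ (suc i@(suc _)) i<n = insert σ τ (fromℕ< i<n) (π σ τ i (ℕ.<⇒≤ i<n))

  J : SignedPerm n → SignedPerm n → List [± n ]
  J σ τ = π σ τ n ℕ.≤-refl

{-# OPTIONS --safe #-}
module Submission where

-- Say that (a , b) with a < b is an inversion of σ if b precedes a in the
-- complete notation of σ, that is, if σ⁻¹ b < σ⁻¹ a.  Two facts give the
-- theorem.
--
-- The weak order is inclusion of inversion sets (≤R⇒⊑ and ⊑⇒≤R).
-- Multiplying u on the right by s i exchanges two values x, y that are
-- adjacent in u and the pair ‾ y, ‾ x; if x < y, this adds exactly the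
-- inversion (x , y) and its mirror image (‾ y , ‾ x).  Counting inversions up
-- to this mirror symmetry therefore gives a function inv that grows by at most
-- one at each letter of a word, and does so exactly at ascents.  If the
-- inversions of u are inversions of v, then either v⁻¹ u is increasing, so
-- that u = v, or some ascent of u is inverted in v and can be performed
-- without leaving the inversion set of v (⊑-step).  Hence v = u ⟦ w ⟧ with w
-- of length inv v - inv u; in particular a word is reduced precisely if its
-- length is the number of inversions.
--
-- The string built at stage i has the right inversions among the letters of
-- absolute value at most i (the record Stage): every inversion of σ or τ is
-- inverted in it, and everything inverted in it is an inversion of each upper
-- bound ρ of σ and τ.  The induction step places i just before C*.
-- * A letter of C is not in H σ i, hence precedes i in σ; the same holds for τ.
-- * The first letter h of C* is in H υ i for υ = σ or υ = τ, so i precedes h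
--   in υ and therefore in ρ.  Let a come after h in C*.  If a < h, then h
--   precedes a in ρ by induction.  If h < a, then h precedes a in υ, so i
--   precedes a in υ and therefore in ρ.
-- * If C* has more than half of the letters, it contains some a together with
--   ‾ a; so i precedes both in ρ, hence also ‾ i.  If C has more than half of
--   the letters, then in the same way ‾ i precedes i in both σ and τ.  If the
--   halves are equal, the signs of σ⁻¹ i and τ⁻¹ i decide.
-- * Inversions that involve ‾ i are mirror images of inversions that involve i.

open import Defs
open SignedPerm using (bijection; odd)
open import Data.Fin.Base as Fin using (Fin; zero; suc; toℕ; inject₁; fromℕ; fromℕ<)
import Data.Fin.Induction as Fin
import Data.Fin.Permutation.Components as Perm
import Data.Fin.Properties as Fin
import Data.Integer.Base as ℤ
import Data.Integer.Properties as ℤ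
open import Data.List.Base
  using (List; []; _∷_; _++_; map; filter; length; reverse; allFin;
         cartesianProduct; take; drop; head; lookup; tabulate)
open import Data.List.Membership.Propositional using (_∈_)
import Data.List.Membership.Propositional.Properties as ∈
import Data.List.Properties as List
import Data.List.Relation.Binary.Subset.DecPropositional as DecSubset
open import Data.List.Relation.Binary.Subset.Propositional using (_⊆_)
open import Data.List.Relation.Unary.All as All using (All; []; _∷_)
import Data.List.Relation.Unary.All.Properties as All
open import Data.List.Relation.Unary.AllPairs as AllPairs using (AllPairs; []; _∷_)
import Data.List.Relation.Unary.AllPairs.Properties as AllPairs
open import Data.List.Relation.Unary.Any as Any using (here; there)
import Data.List.Relation.Unary.Any.Properties as Any
open import Data.List.Relation.Unary.Unique.Propositional using (Unique)
import Data.List.Relation.Unary.Unique.Propositional.Properties as Unique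
import Data.Maybe.Relation.Unary.All as Maybe
open import Data.Nat.Base as ℕ using (ℕ; zero; suc; _+_; _∸_; _≤_; _<_; z≤n; s≤s)
import Data.Nat.Properties as ℕ
open import Data.Product.Base using (Σ-syntax; ∃; ∃₂; _×_; _,_; proj₁; proj₂)
open import Data.Sign.Base as Sign using (Sign)
open import Data.Sum.Base as Sum using (_⊎_; inj₁; inj₂)
open import Function.Base using (_∘_; id; flip)
open import Function.Bundles using (Inverse; mk↔ₛ′)
open import Relation.Binary.Definitions using (Tri; tri<; tri≈; tri>)
open import Relation.Binary.PropositionalEquality
  using (_≡_; _≢_; refl; sym; trans; cong; cong₂; subst; subst₂; module ≡-Reasoning)
open import Relation.Nullary using (¬_; yes; no; contradiction)
open import Relation.Nullary.Decidable using (_×-dec_)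
open import Relation.Unary using (Decidable)

private
  variable
    n : ℕ

-- The linear order of the letters

toℤ-injective : {a b : [± n ]} → toℤ a ≡ toℤ b → a ≡ b
toℤ-injective {a = Sign.+ , j} {Sign.+ , k} eq =
  cong pos (Fin.toℕ-injective (ℕ.suc-injective (ℤ.+-injective eq)))
toℤ-injective {a = Sign.- , j} {Sign.- , k} eq =
  cong neg (Fin.toℕ-injective (ℤ.-[1+-injective eq))

<±-irrefl : {a b : [± n ]} → a ≡ b → ¬ (a <± b)
<±-irrefl eq = ℤ.<-irrefl (cong toℤ eq)

<±-cmp : (a b : [± n ]) → Tri (a <± b) (a ≡ b) (b <± a)
<±-cmp a b with ℤ.<-cmp (toℤ a) (toℤ b)
... | tri< a<b a≢b a≯b = tri< a<b (a≢b ∘ cong toℤ) a≯b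
... | tri≈ a≮b a≡b a≯b = tri≈ a≮b (toℤ-injective a≡b) a≯b
... | tri> a≮b a≢b a>b = tri> a≮b (a≢b ∘ cong toℤ) a>b

‾-involutive : (a : [± n ]) → ‾ ‾ a ≡ a
‾-involutive (Sign.+ , _) = refl
‾-involutive (Sign.- , _) = refl

‾-swap : {a b : [± n ]} → ‾ a ≡ b → a ≡ ‾ b
‾-swap eq = trans (sym (‾-involutive _)) (cong ‾_ eq)

toℤ-‾ : (a : [± n ]) → toℤ (‾ a) ≡ ℤ.- toℤ a
toℤ-‾ (Sign.+ , _) = refl
toℤ-‾ (Sign.- , _) = refl

‾-anti : (a b : [± n ]) → a <± b → ‾ b <± ‾ a
‾-anti a b a<b = subst₂ ℤ._<_ (sym (toℤ-‾ b)) (sym (toℤ-‾ a)) (ℤ.neg-mono-< a<b)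

neg<pos : (j k : Fin n) → neg j <± pos k
neg<pos j k = ℤ.-<+

pos<pos : {j k : Fin n} → toℕ j < toℕ k → pos j <± pos k
pos<pos j<k = ℤ.+<+ (s≤s j<k)

∣∣<⇒<pos : (a : [± n ]) (k : Fin n) → ∣ a ∣ < ∣ pos k ∣ → a <± pos k
∣∣<⇒<pos (Sign.+ , _) k lt = ℤ.+<+ lt
∣∣<⇒<pos (Sign.- , _) k lt = ℤ.-<+

<∧∣∣≡⇒‾ : (a b : [± n ]) → a <± b → ∣ a ∣ ≡ ∣ b ∣ → a ≡ ‾ b
<∧∣∣≡⇒‾ (Sign.+ , j) (Sign.+ , k) (ℤ.+<+ lt) eq = contradiction eq (ℕ.<⇒≢ lt)
<∧∣∣≡⇒‾ (Sign.- , j) (Sign.+ , k) lt eq = cong neg (Fin.toℕ-injective (ℕ.suc-injective eq))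
<∧∣∣≡⇒‾ (Sign.- , j) (Sign.- , k) (ℤ.-<- lt) eq = contradiction (sym eq) (ℕ.<⇒≢ (s≤s lt))

-- Action of the generators on positions

-- s i exchanges the values at the adjacent positions lo i and hi i, and those at
-- their negatives ‾ hi i and ‾ lo i.
lo hi : Fin n → [± n ]
lo zero    = neg zero
lo (suc i) = pos (inject₁ i)
hi = pos

lo<hi : (i : Fin n) → lo i <± hi i
lo<hi zero    = ℤ.-<+
lo<hi (suc i) = ℤ.+<+ (s≤s (s≤s (ℕ.≤-reflexive (Fin.toℕ-inject₁ i))))

-- The transposition of adjacent p < q.  Its arguments are in the order q, p of
-- the inverse map of s i.
module _ (p q : Fin n) (q≡1+p : toℕ q ≡ suc (toℕ p)) where

  private
    swap : Fin n → Fin n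
    swap = Perm.transpose q p

    p<q : toℕ p < toℕ q
    p<q = ℕ.≤-reflexive (sym q≡1+p)

  swap-q : swap q ≡ p
  swap-q with q Fin.≟ q
  ... | yes _  = refl
  ... | no q≢q = contradiction refl q≢q

  swap-p : swap p ≡ q
  swap-p with p Fin.≟ q
  ... | yes p≡q = p≡q
  ... | no _ with p Fin.≟ p
  ...   | yes _ = refl
  ...   | no p≢p = contradiction refl p≢p

  swap-mono : (j k : Fin n) → toℕ j < toℕ k →
              toℕ (swap j) < toℕ (swap k) ⊎ (j ≡ p × k ≡ q)
  swap-mono j k j<k with j Fin.≟ q | k Fin.≟ q
  ... | yes refl | yes refl = contradiction refl (ℕ.<⇒≢ j<k)
  swap-mono j k j<k | yes refl | no k≢q with k Fin.≟ p
  ... | yes refl = contradiction p<q (ℕ.<-asym j<k)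
  ... | no _     = inj₁ (ℕ.<-trans p<q j<k)
  swap-mono j k j<k | no j≢q | yes refl with j Fin.≟ p
  ... | yes refl = inj₂ (refl , refl)
  ... | no j≢p   = inj₁ (ℕ.≤∧≢⇒< (ℕ.≤-pred (ℕ.≤-trans j<k (ℕ.≤-reflexive q≡1+p)))
                                 (j≢p ∘ Fin.toℕ-injective))
  swap-mono j k j<k | no j≢q | no k≢q with j Fin.≟ p | k Fin.≟ p
  ... | yes refl | yes refl = contradiction refl (ℕ.<⇒≢ j<k)
  ... | yes refl | no _     = inj₁ (ℕ.≤∧≢⇒< (ℕ.≤-trans (ℕ.≤-reflexive q≡1+p) j<k)
                                            (k≢q ∘ sym ∘ Fin.toℕ-injective))
  ... | no _     | yes refl = inj₁ (ℕ.<-trans j<k p<q)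
  ... | no _     | no _     = inj₁ j<k

inject₁-adjacent : (i : Fin n) → toℕ (suc i) ≡ suc (toℕ (inject₁ i))
inject₁-adjacent i = cong suc (sym (Fin.toℕ-inject₁ i))

from-s-lo : (i : Fin n) → from (s i) (lo i) ≡ hi i
from-s-lo zero    = refl
from-s-lo (suc i) = cong pos (swap-p _ _ (inject₁-adjacent i))

from-s-hi : (i : Fin n) → from (s i) (hi i) ≡ lo i
from-s-hi zero    = refl
from-s-hi (suc i) = cong pos (swap-q _ _ (inject₁-adjacent i))

-- Among the pairs of positions, s i reverses only the pairs that it exchanges.
from-s-mono : (i : Fin n) (a b : [± n ]) → a <± b →
  from (s i) a <± from (s i) b ⊎
  (a ≡ lo i × b ≡ hi i ⊎ a ≡ ‾ hi i × b ≡ ‾ lo i)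
from-s-mono zero (Sign.+ , zero)  (Sign.+ , suc k) lt = inj₁ ℤ.-<+
from-s-mono zero (Sign.+ , zero)  (Sign.+ , zero) (ℤ.+<+ (s≤s ()))
from-s-mono zero (Sign.+ , suc j) (Sign.+ , zero) (ℤ.+<+ (s≤s ()))
from-s-mono zero (Sign.+ , suc j) (Sign.+ , suc k) lt = inj₁ lt
from-s-mono zero (Sign.- , zero)  (Sign.+ , zero) lt = inj₂ (inj₁ (refl , refl))
from-s-mono zero (Sign.- , zero)  (Sign.+ , suc k) lt = inj₁ (ℤ.+<+ (s≤s (s≤s z≤n)))
from-s-mono zero (Sign.- , suc j) (Sign.+ , zero) lt = inj₁ (ℤ.-<- (s≤s z≤n))
from-s-mono zero (Sign.- , suc j) (Sign.+ , suc k) lt = inj₁ ℤ.-<+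
from-s-mono zero (Sign.- , zero)  (Sign.- , zero) (ℤ.-<- ())
from-s-mono zero (Sign.- , zero)  (Sign.- , suc k) (ℤ.-<- ())
from-s-mono zero (Sign.- , suc j) (Sign.- , zero) lt = inj₁ ℤ.-<+
from-s-mono zero (Sign.- , suc j) (Sign.- , suc k) lt = inj₁ lt
from-s-mono (suc i) (Sign.+ , j) (Sign.+ , k) (ℤ.+<+ (s≤s lt))
  with swap-mono _ _ (inject₁-adjacent i) j k lt
... | inj₁ lt′           = inj₁ (ℤ.+<+ (s≤s lt′))
... | inj₂ (refl , refl) = inj₂ (inj₁ (refl , refl))
from-s-mono (suc i) (Sign.- , j) (Sign.+ , k) lt = inj₁ ℤ.-<+
from-s-mono (suc i) (Sign.- , j) (Sign.- , k) (ℤ.-<- lt)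
  with swap-mono _ _ (inject₁-adjacent i) k j lt
... | inj₁ lt′           = inj₁ (ℤ.-<- lt′)
... | inj₂ (refl , refl) = inj₂ (inj₂ (refl , refl))

-- Order of the values in a signed permutation, and inversions

-- σ ⊢ a ≺ b says that a precedes b in the complete notation of σ.
infix 4 _⊢_≺_
_⊢_≺_ : SignedPerm n → [± n ] → [± n ] → Set
σ ⊢ a ≺ b = from σ a <± from σ b

from-to : (σ : SignedPerm n) (a : [± n ]) → from σ (to σ a) ≡ a
from-to σ a = Inverse.strictlyInverseʳ (bijection σ) a

to-from : (σ : SignedPerm n) (a : [± n ]) → to σ (from σ a) ≡ a
to-from σ a = Inverse.strictlyInverseˡ (bijection σ) a

from-injective : (σ : SignedPerm n) {a b : [± n ]} → from σ a ≡ from σ b → a ≡ b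
from-injective σ eq = trans (sym (to-from σ _)) (trans (cong (to σ) eq) (to-from σ _))

from-odd : (σ : SignedPerm n) (a : [± n ]) → from σ (‾ a) ≡ ‾ from σ a
from-odd σ a = begin
  from σ (‾ a)                   ≡⟨ cong (from σ ∘ ‾_) (to-from σ a) ⟨
  from σ (‾ to σ (from σ a))     ≡⟨ cong (from σ) (odd σ (from σ a)) ⟨
  from σ (to σ (‾ from σ a))     ≡⟨ from-to σ _ ⟩
  ‾ from σ a                     ∎
  where open ≡-Reasoning

from-cong : (σ τ : SignedPerm n) → σ ≈ τ → ∀ a → from σ a ≡ from τ a
from-cong σ τ σ≈τ a = begin
  from σ a                   ≡⟨ cong (from σ) (to-from τ a) ⟨
  from σ (to τ (from τ a))   ≡⟨ cong (from σ) (σ≈τ (from τ a)) ⟨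
  from σ (to σ (from τ a))   ≡⟨ from-to σ _ ⟩
  from τ a                   ∎
  where open ≡-Reasoning

≺-cmp : (σ : SignedPerm n) (a b : [± n ]) →
        Tri (σ ⊢ a ≺ b) (a ≡ b) (σ ⊢ b ≺ a)
≺-cmp σ a b with <±-cmp (from σ a) (from σ b)
... | tri< a<b a≢b a≯b = tri< a<b (a≢b ∘ cong (from σ)) a≯b
... | tri≈ a≮b a≡b a≯b = tri≈ a≮b (from-injective σ a≡b) a≯b
... | tri> a≮b a≢b a>b = tri> a≮b (a≢b ∘ cong (from σ)) a>b

≺-‾ : (σ : SignedPerm n) (a b : [± n ]) → σ ⊢ a ≺ b → σ ⊢ ‾ b ≺ ‾ a
≺-‾ σ a b a≺b =
  subst₂ _<±_ (sym (from-odd σ b)) (sym (from-odd σ a)) (‾-anti _ _ a≺b)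

-- Inclusion of inversion sets.
infix 4 _⊑_
_⊑_ : SignedPerm n → SignedPerm n → Set
σ ⊑ τ = ∀ a b → a <± b → σ ⊢ b ≺ a → τ ⊢ b ≺ a

module _ (u : SignedPerm n) (i : Fin n) where

  private
    -- The values of u at the positions exchanged by s i.
    x y : [± n ]
    x = to u (lo i)
    y = to u (hi i)

    from-x : from u x ≡ lo i
    from-x = from-to u (lo i)

    from-y : from u y ≡ hi i
    from-y = from-to u (hi i)

    x≺y : u ⊢ x ≺ y
    x≺y = subst₂ _<±_ (sym from-x) (sym from-y) (lo<hi i)

    at : ∀ {a p} → from u a ≡ p → a ≡ to u p
    at {a} eq = trans (sym (to-from u a)) (cong (to u) eq)

    ≺-step : ∀ a b → u ⊢ a ≺ b →
             (u · s i) ⊢ a ≺ b ⊎ (a ≡ x × b ≡ y ⊎ a ≡ ‾ y × b ≡ ‾ x)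
    ≺-step a b a≺b with from-s-mono i _ _ a≺b
    ... | inj₁ lt = inj₁ lt
    ... | inj₂ (inj₁ (eq₁ , eq₂)) = inj₂ (inj₁ (at eq₁ , at eq₂))
    ... | inj₂ (inj₂ (eq₁ , eq₂)) =
      inj₂ (inj₂ (trans (at eq₁) (odd u (hi i)) , trans (at eq₂) (odd u (lo i))))

  ·s-swaps : (u · s i) ⊢ y ≺ x
  ·s-swaps = subst₂ _<±_
    (sym (trans (cong (from (s i)) from-y) (from-s-hi i)))
    (sym (trans (cong (from (s i)) from-x) (from-s-lo i)))
    (lo<hi i)

  new-inversion : ∀ a b → a <± b → (u · s i) ⊢ b ≺ a →
                  u ⊢ b ≺ a ⊎ (a ≡ x × b ≡ y ⊎ a ≡ ‾ y × b ≡ ‾ x)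
  new-inversion a b a<b b≺a with ≺-cmp u a b
  ... | tri> _ _ b≺a′ = inj₁ b≺a′
  ... | tri≈ _ refl _ = contradiction a<b (<±-irrefl {a = a} refl)
  ... | tri< a≺b _ _ with ≺-step a b a≺b
  ...   | inj₁ a≺b′ = contradiction a≺b′ (ℤ.<-asym b≺a)
  ...   | inj₂ eqs  = inj₂ eqs

  ascent⇒⊑ : x <± y → u ⊑ u · s i
  ascent⇒⊑ x<y a b a<b b≺a with ≺-step b a b≺a
  ... | inj₁ b≺a′ = b≺a′
  ... | inj₂ (inj₁ (refl , refl)) = contradiction a<b (ℤ.<-asym x<y)
  ... | inj₂ (inj₂ (refl , refl)) = contradiction a<b (ℤ.<-asym (‾-anti x y x<y))

  descent⇒⊒ : y <± x → u · s i ⊑ u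
  descent⇒⊒ y<x a b a<b b≺a with new-inversion a b a<b b≺a
  ... | inj₁ b≺a′ = b≺a′
  ... | inj₂ (inj₁ (refl , refl)) = contradiction a<b (ℤ.<-asym y<x)
  ... | inj₂ (inj₂ (refl , refl)) = contradiction a<b (ℤ.<-asym (‾-anti y x y<x))

  -- At an ascent exactly one normalised inversion (a , b), with ∣ a ∣ ≤ ∣ b ∣,
  -- is created: of (x , y) and its mirror image, the one that is normalised.
  -- Both are if ∣ x ∣ ≡ ∣ y ∣, but then x ≡ ‾ y and they coincide.
  ascent-creates : x <± y → ∃₂ λ a b →
    (a <± b × ∣ a ∣ ≤ ∣ b ∣ × (u · s i) ⊢ b ≺ a) × ¬ (u ⊢ b ≺ a) ×
    (∀ a′ b′ → a′ <± b′ → ∣ a′ ∣ ≤ ∣ b′ ∣ → (u · s i) ⊢ b′ ≺ a′ →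
     u ⊢ b′ ≺ a′ ⊎ (a′ , b′) ≡ (a , b))
  ascent-creates x<y with ℕ.≤-total ∣ x ∣ ∣ y ∣
  ... | inj₁ ∣x∣≤∣y∣ = x , y , (x<y , ∣x∣≤∣y∣ , ·s-swaps) , ℤ.<-asym x≺y , unique
    where
    unique : ∀ a b → a <± b → ∣ a ∣ ≤ ∣ b ∣ → (u · s i) ⊢ b ≺ a →
             u ⊢ b ≺ a ⊎ (a , b) ≡ (x , y)
    unique a b a<b ∣a∣≤∣b∣ b≺a with new-inversion a b a<b b≺a
    ... | inj₁ b≺a′ = inj₁ b≺a′
    ... | inj₂ (inj₁ (refl , refl)) = inj₂ refl
    ... | inj₂ (inj₂ (refl , refl)) = inj₂ (cong₂ _,_ (sym x≡‾y) (sym (‾-swap (sym x≡‾y))))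
      where x≡‾y = <∧∣∣≡⇒‾ x y x<y (ℕ.≤-antisym ∣x∣≤∣y∣ ∣a∣≤∣b∣)
  ... | inj₂ ∣y∣≤∣x∣ = ‾ y , ‾ x , (‾-anti x y x<y , ∣y∣≤∣x∣ , ≺-‾ (u · s i) y x ·s-swaps)
                     , ℤ.<-asym (≺-‾ u x y x≺y) , unique
    where
    unique : ∀ a b → a <± b → ∣ a ∣ ≤ ∣ b ∣ → (u · s i) ⊢ b ≺ a →
             u ⊢ b ≺ a ⊎ (a , b) ≡ (‾ y , ‾ x)
    unique a b a<b ∣a∣≤∣b∣ b≺a with new-inversion a b a<b b≺a
    ... | inj₁ b≺a′ = inj₁ b≺a′
    ... | inj₂ (inj₁ (refl , refl)) = inj₂ (cong₂ _,_ x≡‾y (‾-swap (sym x≡‾y)))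
      where x≡‾y = <∧∣∣≡⇒‾ x y x<y (ℕ.≤-antisym ∣a∣≤∣b∣ ∣y∣≤∣x∣)
    ... | inj₂ (inj₂ (refl , refl)) = inj₂ refl

-- The list of all letters

AllPairs-reverse : {A : Set} {R : A → A → Set} {xs : List A} →
                   AllPairs R xs → AllPairs (flip R) (reverse xs)
AllPairs-reverse [] = []
AllPairs-reverse {R = R} {x ∷ xs} (Rx ∷ Rxs) =
  subst (AllPairs (flip R)) (sym (List.unfold-reverse x xs))
    (AllPairs.++⁺ (AllPairs-reverse Rxs) ([] ∷ [])
      (All.map (_∷ []) (All.tabulate (All.lookup Rx ∘ Any.reverse⁻))))

ascending-sorted : (n : ℕ) → AllPairs _<±_ (ascending n)
ascending-sorted n = AllPairs.++⁺
  (AllPairs.map⁺ (AllPairs-reverse (AllPairs.map (λ lt → ℤ.-<- lt) allFin-sorted)))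
  (AllPairs.map⁺ (AllPairs.map pos<pos allFin-sorted))
  (All.map⁺ (All.tabulate λ {j} _ → All.map⁺ (All.tabulate λ {k} _ → neg<pos j k)))
  where
  allFin-sorted : AllPairs Fin._<_ (allFin n)
  allFin-sorted = AllPairs.tabulate⁺-< id

∈-ascending : (a : [± n ]) → a ∈ ascending n
∈-ascending (Sign.+ , k) = ∈.∈-++⁺ʳ (map neg (reverse (allFin _))) (∈.∈-map⁺ pos (∈.∈-allFin k))
∈-ascending (Sign.- , k) = ∈.∈-++⁺ˡ (∈.∈-map⁺ neg (Any.reverse⁺ (∈.∈-allFin k)))

ascending-unique : (n : ℕ) → Unique (ascending n)
ascending-unique n = AllPairs.map (λ a<b a≡b → <±-irrefl a≡b a<b) (ascending-sorted n)

-- Counting inversions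

module _ {A : Set} {P Q : A → Set} (P? : Decidable P) (Q? : Decidable Q)
         (P⊆Q : ∀ {x} → P x → Q x) where

  count-mono : ∀ xs → length (filter P? xs) ≤ length (filter Q? xs)
  count-mono [] = z≤n
  count-mono (x ∷ xs) with P? x | Q? x
  ... | yes _  | yes _  = s≤s (count-mono xs)
  ... | yes px | no ¬qx = contradiction (P⊆Q px) ¬qx
  ... | no _   | yes _  = ℕ.m≤n⇒m≤1+n (count-mono xs)
  ... | no _   | no _   = count-mono xs

  count-≡ : ∀ {xs} → All (λ x → Q x → P x) xs →
            length (filter P? xs) ≡ length (filter Q? xs)
  count-≡ [] = refl
  count-≡ {x ∷ xs} (Q⇒P ∷ Q⇒Ps) with P? x | Q? x
  ... | yes _  | yes _  = cong suc (count-≡ Q⇒Ps)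
  ... | yes px | no ¬qx = contradiction (P⊆Q px) ¬qx
  ... | no ¬px | yes qx = contradiction (Q⇒P qx) ¬px
  ... | no _   | no _   = count-≡ Q⇒Ps

  -- If Q holds at one more point t than P, the count increases by one.
  count-suc : ∀ {t} → Q t → ¬ P t → (∀ {x} → Q x → P x ⊎ x ≡ t) →
              ∀ {xs} → Unique xs → t ∈ xs →
              length (filter Q? xs) ≡ suc (length (filter P? xs))
  count-suc qt ¬pt Q⊆P∪t {x ∷ xs} (x∉xs ∷ _) (here refl) with P? x | Q? x
  ... | yes px | _      = contradiction px ¬pt
  ... | no _   | no ¬qx = contradiction qt ¬qx
  ... | no _   | yes _  = cong suc (sym (count-≡ (All.map Q⇒P x∉xs)))
    where
    Q⇒P : ∀ {y} → x ≢ y → Q y → P y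
    Q⇒P x≢y qy with Q⊆P∪t qy
    ... | inj₁ py  = py
    ... | inj₂ y≡x = contradiction (sym y≡x) x≢y
  count-suc qt ¬pt Q⊆P∪t {x ∷ xs} (x∉xs ∷ xs!) (there t∈xs) with P? x | Q? x
  ... | yes _  | yes _  = cong suc (count-suc qt ¬pt Q⊆P∪t xs! t∈xs)
  ... | yes px | no ¬qx = contradiction (P⊆Q px) ¬qx
  ... | no _   | no _   = count-suc qt ¬pt Q⊆P∪t xs! t∈xs
  ... | no ¬px | yes qx with Q⊆P∪t qx
  ...   | inj₁ px  = contradiction px ¬px
  ...   | inj₂ x≡t = contradiction x≡t (All.lookup x∉xs t∈xs)

-- Inversions are counted up to (a , b) ↦ (‾ b , ‾ a), so as to correspond to
-- reflections: of two mirror images, the one with ∣ a ∣ ≤ ∣ b ∣ is counted, and a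
-- pair with ∣ a ∣ ≡ ∣ b ∣ is (‾ b , b), its own mirror image.
Inversion : SignedPerm n → [± n ] × [± n ] → Set
Inversion σ (a , b) = a <± b × ∣ a ∣ ≤ ∣ b ∣ × σ ⊢ b ≺ a

inversion? : (σ : SignedPerm n) → Decidable (Inversion σ)
inversion? σ (a , b) =
  (a <±? b) ×-dec (∣ a ∣ ℕ.≤? ∣ b ∣) ×-dec (from σ b <±? from σ a)

pairs : (n : ℕ) → List ([± n ] × [± n ])
pairs n = cartesianProduct (ascending n) (ascending n)

-- The number of inversions up to mirror symmetry; by reduced⇒length below, it is
-- the Coxeter length.
inv : SignedPerm n → ℕ
inv {n} σ = length (filter (inversion? σ) (pairs n))

inv-ε : (n : ℕ) → inv {n} ε ≡ 0
inv-ε n = cong length (List.filter-none (inversion? ε)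
  (All.tabulate {xs = pairs n} λ { _ (a<b , _ , b<a) → ℤ.<-asym a<b b<a }))

⊑⇒inv≤ : (σ τ : SignedPerm n) → σ ⊑ τ → inv σ ≤ inv τ
⊑⇒inv≤ {n} σ τ σ⊑τ = count-mono (inversion? σ) (inversion? τ)
  (λ { {a , b} (a<b , ∣a∣≤∣b∣ , b≺a) → a<b , ∣a∣≤∣b∣ , σ⊑τ a b a<b b≺a }) (pairs n)

≈⇒⊑ : (σ τ : SignedPerm n) → σ ≈ τ → σ ⊑ τ
≈⇒⊑ σ τ σ≈τ a b _ = subst₂ _<±_ (from-cong σ τ σ≈τ b) (from-cong σ τ σ≈τ a)

≈-sym : (σ τ : SignedPerm n) → σ ≈ τ → τ ≈ σ
≈-sym σ τ σ≈τ a = sym (σ≈τ a)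

≈⇒inv≡ : (σ τ : SignedPerm n) → σ ≈ τ → inv σ ≡ inv τ
≈⇒inv≡ σ τ σ≈τ = ℕ.≤-antisym (⊑⇒inv≤ σ τ (≈⇒⊑ σ τ σ≈τ))
                             (⊑⇒inv≤ τ σ (≈⇒⊑ τ σ (≈-sym σ τ σ≈τ)))

module _ (u : SignedPerm n) (i : Fin n) where

  ascent⇒inv-suc : to u (lo i) <± to u (hi i) → inv (u · s i) ≡ suc (inv u)
  ascent⇒inv-suc asc with ascent-creates u i asc
  ... | a , b , new , old , unique = count-suc (inversion? u) (inversion? (u · s i))
    (λ { {c , d} (c<d , ∣c∣≤∣d∣ , d≺c) → c<d , ∣c∣≤∣d∣ , ascent⇒⊑ u i asc c d c<d d≺c })
    new (old ∘ proj₂ ∘ proj₂)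
    (λ { {c , d} (c<d , ∣c∣≤∣d∣ , d≺c) →
         Sum.map₁ (λ d≺c′ → c<d , ∣c∣≤∣d∣ , d≺c′) (unique c d c<d ∣c∣≤∣d∣ d≺c) })
    (Unique.cartesianProduct⁺ (ascending-unique n) (ascending-unique n))
    (∈.∈-cartesianProduct⁺ (∈-ascending a) (∈-ascending b))

  ascent⊎descent : to u (lo i) <± to u (hi i) ⊎ to u (hi i) <± to u (lo i)
  ascent⊎descent with <±-cmp (to u (lo i)) (to u (hi i))
  ... | tri< x<y _ _ = inj₁ x<y
  ... | tri> _ _ y<x = inj₂ y<x
  ... | tri≈ _ x≡y _ = contradiction (lo<hi i)
    (<±-irrefl (trans (sym (from-to u _)) (trans (cong (from u) x≡y) (from-to u _))))

  inv-·s≤ : inv (u · s i) ≤ suc (inv u)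
  inv-·s≤ with ascent⊎descent
  ... | inj₁ asc  = ℕ.≤-reflexive (ascent⇒inv-suc asc)
  ... | inj₂ desc = ℕ.m≤n⇒m≤1+n (⊑⇒inv≤ (u · s i) u (descent⇒⊒ u i desc))

  inv-·s-suc⇒⊑ : inv (u · s i) ≡ suc (inv u) → u ⊑ u · s i
  inv-·s-suc⇒⊑ eq with ascent⊎descent
  ... | inj₁ asc  = ascent⇒⊑ u i asc
  ... | inj₂ desc = contradiction (sym eq)
    (ℕ.<⇒≢ (s≤s (⊑⇒inv≤ (u · s i) u (descent⇒⊒ u i desc))) ∘ sym)

-- Increasing odd maps

≤pos-top : (a : [± suc n ]) → toℤ a ℤ.≤ toℤ (pos (fromℕ n))
≤pos-top {n} (Sign.+ , k) =
  ℤ.+≤+ (s≤s (subst (toℕ k ≤_) (sym (Fin.toℕ-fromℕ n)) (ℕ.≤-pred (Fin.toℕ<n k))))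
≤pos-top (Sign.- , k) = ℤ.-≤+

module _ (f : [± suc n ] → [± suc n ]) (f-mono : ∀ i → f (lo i) <± f (hi i)) where

  monotone⇒≥ : (∀ a → f (‾ a) ≡ ‾ f a) → ∀ k → toℤ (pos k) ℤ.≤ toℤ (f (pos k))
  monotone⇒≥ f-odd = Fin.<-weakInduction _
    (‾<⇒≥1 _ (subst (_<± f (pos zero)) (f-odd (pos zero)) (f-mono zero)))
    (λ i ih → ℤ.i<j⇒suc[i]≤j (ℤ.≤-<-trans
      (subst (ℤ._≤ toℤ (f (pos (inject₁ i)))) (toℤ-inject₁ i) ih) (f-mono (suc i))))
    where
    ‾<⇒≥1 : (a : [± suc n ]) → ‾ a <± a → ℤ.+ 1 ℤ.≤ toℤ a
    ‾<⇒≥1 (Sign.+ , k) _ = ℤ.+≤+ (s≤s z≤n)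

    toℤ-inject₁ : (i : Fin n) → toℤ (pos (inject₁ i)) ≡ ℤ.+ suc (toℕ i)
    toℤ-inject₁ i = cong (λ m → ℤ.+ suc m) (Fin.toℕ-inject₁ i)

  monotone⇒≤ : ∀ k → toℤ (f (pos k)) ℤ.≤ toℤ (pos k)
  monotone⇒≤ = Fin.>-weakInduction _ (≤pos-top (f (pos (fromℕ n))))
    (λ i ih → subst (λ m → toℤ (f (pos (inject₁ i))) ℤ.≤ ℤ.+ suc m)
                    (sym (Fin.toℕ-inject₁ i))
                    (ℤ.i<j⇒i≤pred[j] (ℤ.<-≤-trans (f-mono (suc i)) ih)))

-- By induction along the positive letters, upwards from 1 and downwards from n,
-- f (pos k) is at least and at most pos k.
monotone⇒id : (f : [± n ] → [± n ]) → (∀ a → f (‾ a) ≡ ‾ f a) →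
              (∀ i → f (lo i) <± f (hi i)) → ∀ a → f a ≡ a
monotone⇒id {suc n} f f-odd f-mono (Sign.+ , k) =
  toℤ-injective (ℤ.≤-antisym (monotone⇒≤ f f-mono k) (monotone⇒≥ f f-mono f-odd k))
monotone⇒id {suc n} f f-odd f-mono (Sign.- , k) =
  trans (f-odd (pos k)) (cong ‾_ (monotone⇒id f f-odd f-mono (pos k)))

-- The weak order is inclusion of inversion sets

⟦⟧-++ : (p q : Word n) → ⟦ p ++ q ⟧ ≈ ⟦ p ⟧ · ⟦ q ⟧
⟦⟧-++ []      q a = refl
⟦⟧-++ (i ∷ p) q a = cong (to (s i)) (⟦⟧-++ p q a)

inv-·⟦⟧≤ : (u : SignedPerm n) (w : Word n) → inv (u · ⟦ w ⟧) ≤ inv u + length w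
inv-·⟦⟧≤ u []      = ℕ.≤-reflexive (sym (ℕ.+-identityʳ _))
inv-·⟦⟧≤ u (i ∷ w) = begin
  inv (u · ⟦ i ∷ w ⟧)         ≤⟨ inv-·⟦⟧≤ (u · s i) w ⟩
  inv (u · s i) + length w    ≤⟨ ℕ.+-monoˡ-≤ (length w) (inv-·s≤ u i) ⟩
  suc (inv u + length w)      ≡⟨ ℕ.+-suc _ _ ⟨
  inv u + suc (length w)      ∎
  where open ℕ.≤-Reasoning

-- If every letter of w increases inv, every step is an ascent, and inversions are
-- only gained.
⊑-·⟦⟧ : (u : SignedPerm n) (w : Word n) →
        inv (u · ⟦ w ⟧) ≡ inv u + length w → u ⊑ u · ⟦ w ⟧
⊑-·⟦⟧ u []      eq a b a<b b≺a = b≺a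
⊑-·⟦⟧ u (i ∷ w) eq a b a<b b≺a =
  ⊑-·⟦⟧ (u · s i) w eq′ a b a<b (inv-·s-suc⇒⊑ u i step a b a<b b≺a)
  where
  step : inv (u · s i) ≡ suc (inv u)
  step = ℕ.≤-antisym (inv-·s≤ u i) (ℕ.+-cancelʳ-≤ (length w) _ _ (begin
    suc (inv u) + length w     ≡⟨ ℕ.+-suc _ _ ⟨
    inv u + suc (length w)     ≡⟨ eq ⟨
    inv (u · s i · ⟦ w ⟧)      ≤⟨ inv-·⟦⟧≤ (u · s i) w ⟩
    inv (u · s i) + length w   ∎))
    where open ℕ.≤-Reasoning

  eq′ : inv ((u · s i) · ⟦ w ⟧) ≡ inv (u · s i) + length w
  eq′ = trans eq (trans (ℕ.+-suc _ _) (cong (_+ length w) (sym step)))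

module _ (u v : SignedPerm n) (u⊑v : u ⊑ v) where

  -- If v⁻¹ u is increasing, then u ≈ v.  If not, v inverts the values of u at
  -- some adjacent positions; they form an ascent of u, and exchanging them adds
  -- only inversions of v.
  ⊑-step : u ≈ v ⊎ ∃ λ i → inv (u · s i) ≡ suc (inv u) × u · s i ⊑ v
  ⊑-step with Fin.all? (λ i → from v (to u (lo i)) <±? from v (to u (hi i)))
  ... | yes mono = inj₁ λ a → trans (sym (to-from v (to u a))) (cong (to v) (v⁻¹u≡id a))
    where
    v⁻¹u≡id : ∀ a → from v (to u a) ≡ a
    v⁻¹u≡id = monotone⇒id (from v ∘ to u)
      (λ a → trans (cong (from v) (odd u a)) (from-odd v (to u a))) mono
  ... | no ¬mono = inj₂ (i , ascent⇒inv-suc u i asc , us⊑v)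
    where
    bad = Fin.¬∀⟶∃¬ n _ (λ i → from v (to u (lo i)) <±? from v (to u (hi i))) ¬mono
    i = proj₁ bad
    x = to u (lo i)
    y = to u (hi i)

    x≺y : u ⊢ x ≺ y
    x≺y = subst₂ _<±_ (sym (from-to u _)) (sym (from-to u _)) (lo<hi i)

    y≺x : v ⊢ y ≺ x
    y≺x with ≺-cmp v x y
    ... | tri< x≺y′ _ _ = contradiction x≺y′ (proj₂ bad)
    ... | tri≈ _ x≡y _  = contradiction x≺y (<±-irrefl (cong (from u) x≡y))
    ... | tri> _ _ y≺x′ = y≺x′

    asc : x <± y
    asc with ascent⊎descent u i
    ... | inj₁ x<y = x<y
    ... | inj₂ y<x = contradiction (u⊑v y x y<x x≺y) (ℤ.<-asym y≺x)

    us⊑v : u · s i ⊑ v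
    us⊑v a b a<b b≺a with new-inversion u i a b a<b b≺a
    ... | inj₁ b≺a′ = u⊑v a b a<b b≺a′
    ... | inj₂ (inj₁ (refl , refl)) = y≺x
    ... | inj₂ (inj₂ (refl , refl)) = ≺-‾ v y x y≺x

⊑⇒∃word : (u v : SignedPerm n) → u ⊑ v →
          ∃ λ w → u · ⟦ w ⟧ ≈ v × inv v ≡ inv u + length w
⊑⇒∃word {n} u₀ v u₀⊑v = go (inv v) u₀ u₀⊑v (ℕ.m≤n+m (inv v) (inv u₀))
  where
  -- d bounds the number of ascents still to be performed.
  go : (d : ℕ) (u : SignedPerm n) → u ⊑ v → inv v ≤ inv u + d →
       ∃ λ w → u · ⟦ w ⟧ ≈ v × inv v ≡ inv u + length w
  go d u u⊑v bound with ⊑-step u v u⊑v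
  ... | inj₁ u≈v = [] , u≈v , trans (≈⇒inv≡ v u (≈-sym u v u≈v)) (sym (ℕ.+-identityʳ _))
  go zero u u⊑v bound | inj₂ (i , eq , us⊑v) = contradiction
    (ℕ.≤-trans (ℕ.≤-trans (ℕ.≤-reflexive (sym eq)) (⊑⇒inv≤ (u · s i) v us⊑v))
               (ℕ.≤-trans bound (ℕ.≤-reflexive (ℕ.+-identityʳ _))))
    (ℕ.<-irrefl refl)
  go (suc d) u u⊑v bound | inj₂ (i , eq , us⊑v)
    with go d (u · s i) us⊑v (ℕ.≤-trans bound
           (ℕ.≤-reflexive (trans (ℕ.+-suc _ _) (cong (_+ d) (sym eq)))))
  ... | w , usw≈v , eq′ =
    i ∷ w , usw≈v , trans eq′ (trans (cong (_+ length w) eq) (sym (ℕ.+-suc _ _)))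

ε⊑ : (u : SignedPerm n) → ε ⊑ u
ε⊑ u a b a<b b<a = contradiction a<b (ℤ.<-asym b<a)

reduced-word : (u : SignedPerm n) → ∃ λ w → ⟦ w ⟧ ≈ u × inv u ≡ length w
reduced-word {n} u with ⊑⇒∃word ε u (ε⊑ u)
... | w , w≈u , eq = w , w≈u , trans eq (cong (_+ length w) (inv-ε n))

inv≤length : (u : SignedPerm n) (w : Word n) → ⟦ w ⟧ ≈ u → inv u ≤ length w
inv≤length {n} u w w≈u = begin
  inv u                  ≡⟨ ≈⇒inv≡ ⟦ w ⟧ u w≈u ⟨
  inv (ε · ⟦ w ⟧)        ≤⟨ inv-·⟦⟧≤ ε w ⟩
  inv {n} ε + length w   ≡⟨ cong (_+ length w) (inv-ε n) ⟩
  length w               ∎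
  where open ℕ.≤-Reasoning

reduced⇒length : (u : SignedPerm n) (w : Word n) →
                 ReducedExpression w u → inv u ≡ length w
reduced⇒length u w (w≈u , minimal) with reduced-word u
... | w′ , w′≈u , eq = ℕ.≤-antisym (inv≤length u w w≈u)
  (ℕ.≤-trans (minimal w′ w′≈u) (ℕ.≤-reflexive (sym eq)))

length⇒reduced : (u : SignedPerm n) (w : Word n) →
                 ⟦ w ⟧ ≈ u → inv u ≡ length w → ReducedExpression w u
length⇒reduced u w w≈u eq =
  w≈u , λ w′ w′≈u → ℕ.≤-trans (ℕ.≤-reflexive (sym eq)) (inv≤length u w′ w′≈u)

≤R⇒⊑ : (u v : SignedPerm n) → u ≤R v → u ⊑ v
≤R⇒⊑ u v (p , q , p-red , pq-red) a b a<b b≺a =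
  ≈⇒⊑ (u · ⟦ q ⟧) v uq≈v a b a<b (⊑-·⟦⟧ u q eq a b a<b b≺a)
  where
  uq≈v : u · ⟦ q ⟧ ≈ v
  uq≈v c = trans (sym (proj₁ p-red _)) (trans (sym (⟦⟧-++ p q c)) (proj₁ pq-red c))

  eq : inv (u · ⟦ q ⟧) ≡ inv u + length q
  eq = begin
    inv (u · ⟦ q ⟧)        ≡⟨ ≈⇒inv≡ (u · ⟦ q ⟧) v uq≈v ⟩
    inv v                  ≡⟨ reduced⇒length v (p ++ q) pq-red ⟩
    length (p ++ q)        ≡⟨ List.length-++ p ⟩
    length p + length q    ≡⟨ cong (_+ length q) (reduced⇒length u p p-red) ⟨
    inv u + length q       ∎
    where open ≡-Reasoning

⊑⇒≤R : (u v : SignedPerm n) → u ⊑ v → u ≤R v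
⊑⇒≤R u v u⊑v with reduced-word u | ⊑⇒∃word u v u⊑v
... | p , p≈u , eqᵤ | q , uq≈v , eqᵥ =
  p , q , length⇒reduced u p p≈u eqᵤ , length⇒reduced v (p ++ q) pq≈v eq
  where
  pq≈v : ⟦ p ++ q ⟧ ≈ v
  pq≈v c = trans (⟦⟧-++ p q c) (trans (p≈u _) (uq≈v c))

  eq : inv v ≡ length (p ++ q)
  eq = trans eqᵥ (trans (cong (_+ length q) eqᵤ) (sym (List.length-++ p)))

-- Splitting lists and inserting into them

∈-nonempty : {A : Set} {xs : List A} → 0 < length xs → ∃ (_∈ xs)
∈-nonempty {xs = x ∷ _} _ = x , here refl

++-injective : {A : Set} (xs zs : List A) {ys ws : List A} → length xs ≡ length zs →
               xs ++ ys ≡ zs ++ ws → xs ≡ zs × ys ≡ ws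
++-injective []       []       _   eq = refl , eq
++-injective (x ∷ xs) (z ∷ zs) len eq with List.∷-injective eq
... | refl , eq′ with ++-injective xs zs (ℕ.suc-injective len) eq′
...   | refl , eq″ = refl , eq″

∈-insert : {A : Set} (xs : List A) {ys : List A} {v x : A} →
           x ∈ xs ++ ys → x ∈ xs ++ v ∷ ys
∈-insert []       x∈         = there x∈
∈-insert (_ ∷ xs) (here eq)  = here eq
∈-insert (_ ∷ xs) (there x∈) = there (∈-insert xs x∈)

module _ {A : Set} {R : A → A → Set} where

  AllPairs-suffix : ∀ xs {ys} → AllPairs R (xs ++ ys) → AllPairs R ys
  AllPairs-suffix []       Rys       = Rys
  AllPairs-suffix (x ∷ xs) (_ ∷ Rxs) = AllPairs-suffix xs Rxs

  AllPairs-across : ∀ xs {ys x y} → AllPairs R (xs ++ ys) → x ∈ xs → y ∈ ys → R x y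
  AllPairs-across (x ∷ xs) (Rx ∷ _) (here refl) y∈ = All.lookup Rx (∈.∈-++⁺ʳ xs y∈)
  AllPairs-across (x ∷ xs) (_ ∷ Rxs) (there x∈) y∈ = AllPairs-across xs Rxs x∈ y∈

  AllPairs-insert : ∀ xs {ys v} → AllPairs R (xs ++ ys) →
                    (∀ {x} → x ∈ xs → R x v) → (∀ {y} → y ∈ ys → R v y) →
                    AllPairs R (xs ++ v ∷ ys)
  AllPairs-insert []       Rys        _   v≤ = All.tabulate v≤ ∷ Rys
  AllPairs-insert (x ∷ xs) (Rx ∷ Rxs) ≤v  v≤ =
    All.++⁺ (All.++⁻ˡ xs Rx) (≤v (here refl) ∷ All.++⁻ʳ xs Rx) ∷
    AllPairs-insert xs Rxs (≤v ∘ there) v≤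

-- Strings symmetric under reversal with negation

-- The effect on a string of reversing it and negating its entries; the complete
-- notation of a signed permutation is fixed by rev.
rev : List [± n ] → List [± n ]
rev xs = reverse (map ‾_ xs)

rev-++ : (xs ys : List [± n ]) → rev (xs ++ ys) ≡ rev ys ++ rev xs
rev-++ xs ys = trans (cong reverse (List.map-++ ‾_ xs ys))
                     (List.reverse-++ (map ‾_ xs) (map ‾_ ys))

length-rev : (xs : List [± n ]) → length (rev xs) ≡ length xs
length-rev xs = trans (List.length-reverse (map ‾_ xs)) (List.length-map ‾_ xs)

∈-rev : {xs : List [± n ]} {a : [± n ]} → a ∈ xs → ‾ a ∈ rev xs
∈-rev a∈xs = Any.reverse⁺ (∈.∈-map⁺ ‾_ a∈xs)

rev-involutive : (xs : List [± n ]) → rev (rev xs) ≡ xs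
rev-involutive xs = begin
  reverse (map ‾_ (reverse (map ‾_ xs)))   ≡⟨ cong reverse (List.reverse-map ‾_ (map ‾_ xs)) ⟩
  reverse (reverse (map ‾_ (map ‾_ xs)))   ≡⟨ List.reverse-involutive _ ⟩
  map ‾_ (map ‾_ xs)                       ≡⟨ List.map-∘ xs ⟨
  map (‾_ ∘ ‾_) xs                         ≡⟨ List.map-cong ‾-involutive xs ⟩
  map id xs                                ≡⟨ List.map-id xs ⟩
  xs                                       ∎
  where open ≡-Reasoning

∈-rev⁻ : (xs : List [± n ]) {ys : List [± n ]} → rev xs ≡ ys →
         {a : [± n ]} → a ∈ ys → ‾ a ∈ xs
∈-rev⁻ xs refl a∈ = subst (_ ∈_) (rev-involutive xs) (∈-rev a∈)

-- In a string fixed by rev, cut symmetrically, the middle part is fixed and the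
-- outer parts are exchanged.
palindrome : (A M B : List [± n ]) → length A ≡ length B →
             rev (A ++ M ++ B) ≡ A ++ M ++ B → rev M ≡ M × rev A ≡ B
palindrome A M B ∣A∣≡∣B∣ eq = ++-injective (rev M) M (length-rev M) (proj₂
  (++-injective (rev B) A (trans (length-rev B) (sym ∣A∣≡∣B∣)) (begin
    rev B ++ rev M ++ rev A     ≡⟨ List.++-assoc (rev B) (rev M) (rev A) ⟨
    (rev B ++ rev M) ++ rev A   ≡⟨ cong (_++ rev A) (rev-++ M B) ⟨
    rev (M ++ B) ++ rev A       ≡⟨ rev-++ A (M ++ B) ⟨
    rev (A ++ M ++ B)           ≡⟨ eq ⟩
    A ++ M ++ B                 ∎)))
  where open ≡-Reasoning

-- The letters e and ‾ e placed around the middle part of A ++ M ++ B.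
around : [± n ] → (A M B : List [± n ]) → List [± n ]
around e A M B = A ++ e ∷ M ++ ‾ e ∷ B

rev-around : (e : [± n ]) (A M B : List [± n ]) → rev M ≡ M → rev A ≡ B →
             rev (around e A M B) ≡ around e A M B
rev-around e A M B revM refl = begin
  rev (A ++ e ∷ M ++ ‾ e ∷ rev A)
    ≡⟨ rev-++ A _ ⟩
  rev (e ∷ M ++ ‾ e ∷ rev A) ++ rev A
    ≡⟨ cong (_++ rev A) (rev-++ (e ∷ []) (M ++ ‾ e ∷ rev A)) ⟩
  (rev (M ++ ‾ e ∷ rev A) ++ ‾ e ∷ []) ++ rev A
    ≡⟨ List.++-assoc (rev (M ++ ‾ e ∷ rev A)) _ _ ⟩
  rev (M ++ ‾ e ∷ rev A) ++ ‾ e ∷ rev A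
    ≡⟨ cong (_++ ‾ e ∷ rev A) (rev-++ M _) ⟩
  (rev (‾ e ∷ rev A) ++ rev M) ++ ‾ e ∷ rev A
    ≡⟨ cong₂ (λ X Y → (X ++ Y) ++ ‾ e ∷ rev A) (rev-++ (‾ e ∷ []) (rev A)) revM ⟩
  ((rev (rev A) ++ ‾ ‾ e ∷ []) ++ M) ++ ‾ e ∷ rev A
    ≡⟨ cong₂ (λ X x → ((X ++ x ∷ []) ++ M) ++ ‾ e ∷ rev A) (rev-involutive A) (‾-involutive e) ⟩
  ((A ++ e ∷ []) ++ M) ++ ‾ e ∷ rev A
    ≡⟨ List.++-assoc (A ++ e ∷ []) M _ ⟩
  (A ++ e ∷ []) ++ M ++ ‾ e ∷ rev A
    ≡⟨ List.++-assoc A _ _ ⟩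
  A ++ e ∷ M ++ ‾ e ∷ rev A ∎
  where open ≡-Reasoning

length-around : (e : [± n ]) (A M B : List [± n ]) →
                length (around e A M B) ≡ 2 + length (A ++ M ++ B)
length-around e A M B = begin
  length (A ++ e ∷ M ++ ‾ e ∷ B)          ≡⟨ List.length-++-sucʳ A e _ ⟩
  suc (length (A ++ M ++ ‾ e ∷ B))        ≡⟨ cong (λ xs → suc (length xs)) (List.++-assoc A M _) ⟨
  suc (length ((A ++ M) ++ ‾ e ∷ B))      ≡⟨ cong suc (List.length-++-sucʳ (A ++ M) (‾ e) B) ⟩
  suc (suc (length ((A ++ M) ++ B)))      ≡⟨ cong (λ xs → 2 + length xs) (List.++-assoc A M B) ⟩
  suc (suc (length (A ++ M ++ B)))        ∎
  where open ≡-Reasoning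

∈-around : (e : [± n ]) (A M B : List [± n ]) {a : [± n ]} →
           a ∈ A ++ M ++ B → a ∈ around e A M B
∈-around e A M B a∈ = ∈-insert A (subst (_ ∈_) (List.++-assoc A M _)
  (∈-insert (A ++ M) (subst (_ ∈_) (sym (List.++-assoc A M B)) a∈)))

e∈around : (e : [± n ]) (A M B : List [± n ]) → e ∈ around e A M B
e∈around e A M B = ∈.∈-insert A

‾e∈around : (e : [± n ]) (A M B : List [± n ]) → ‾ e ∈ around e A M B
‾e∈around e A M B = ∈.∈-++⁺ʳ A (there (∈.∈-insert M))

All-around : {P : [± n ] → Set} (e : [± n ]) (A M B : List [± n ]) →
             P e → P (‾ e) → All P (A ++ M ++ B) → All P (around e A M B)
All-around e A M B pe p‾e ps = All.++⁺ (All.++⁻ˡ A ps)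
  (pe ∷ All.++⁺ (All.++⁻ˡ M (All.++⁻ʳ A ps)) (p‾e ∷ All.++⁻ʳ M (All.++⁻ʳ A ps)))

AllPairs-around : {R : [± n ] → [± n ] → Set} (e : [± n ]) (A M B : List [± n ]) →
  AllPairs R (A ++ M ++ B) →
  (∀ {x} → x ∈ A → R x e) → (∀ {y} → y ∈ M ++ B → R e y) →
  (∀ {x} → x ∈ A ++ M → R x (‾ e)) → (∀ {y} → y ∈ B → R (‾ e) y) →
  R e (‾ e) → AllPairs R (around e A M B)
AllPairs-around {R = R} e A M B Rs <e e< <‾e ‾e< e<‾e = AllPairs-insert A
  (subst (AllPairs _) (List.++-assoc A M _)
    (AllPairs-insert (A ++ M) (subst (AllPairs _) (sym (List.++-assoc A M B)) Rs) <‾e ‾e<))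
  <e e<′
  where
  e<′ : ∀ {y} → y ∈ M ++ ‾ e ∷ B → R e y
  e<′ y∈ with ∈.∈-++⁻ M y∈
  ... | inj₁ y∈M           = e< (∈.∈-++⁺ˡ y∈M)
  ... | inj₂ (here refl)   = e<‾e
  ... | inj₂ (there y∈B)   = e< (∈.∈-++⁺ʳ M y∈B)

-- The two places of a new letter

-- xs contains some letter together with its negative.
DoublyIn : List [± n ] → Set
DoublyIn xs = ∃ λ a → a ∈ xs × ‾ a ∈ xs

module _ {n : ℕ} (σ τ : SignedPerm n) (k : Fin n) where

  BothPositive : Set
  BothPositive = Positive (from σ (pos k)) × Positive (from τ (pos k))

  -- Placed C C* L′ says that L′ arises from C ++ C* by placing the letters pos k
  -- and neg k symmetrically, with pos k between C and C*; in the first case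
  -- pos k is to the left of neg k, in the second to the right.  The last
  -- argument records what justifies this order: a letter that occurs together
  -- with its negative in C* (first case) or in C (second case), or else the signs
  -- of pos k under the inverses of σ and τ.
  data Placed : (C C* π′ : List [± n ]) → Set where
    pos-neg : ∀ A M B → rev M ≡ M → rev A ≡ B → DoublyIn (M ++ B) ⊎ ¬ BothPositive →
              Placed A (M ++ B) (around (pos k) A M B)
    neg-pos : ∀ A M B → rev M ≡ M → rev A ≡ B → DoublyIn (A ++ M) ⊎ BothPositive →
              Placed (A ++ M) B (around (neg k) A M B)

  -- The case of equal halves, where the middle part is empty.
  centre-placed : ∀ C C* → length C ≡ length C* → rev (C ++ C*) ≡ C ++ C* →
                  Placed C C* (C ++ centre σ τ k ++ C*)
  centre-placed C C* ∣C∣≡∣C*∣ sym-π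
    with positive? (from σ (pos k)) ×-dec positive? (from τ (pos k))
  ... | yes both = subst (λ X → Placed X C* (C ++ neg k ∷ pos k ∷ C*)) (List.++-identityʳ C)
    (neg-pos C [] C* refl (proj₂ (palindrome C [] C* ∣C∣≡∣C*∣ sym-π)) (inj₂ both))
  ... | no ¬both =
    pos-neg C [] C* refl (proj₂ (palindrome C [] C* ∣C∣≡∣C*∣ sym-π)) (inj₂ ¬both)

  -- In the unequal cases the middle part M is nonempty and fixed by rev, so it
  -- contains some letter together with its negative.
  insert-placed : ∀ L → rev L ≡ L → length L ≡ toℕ k + toℕ k →
    let hs = H σ k ++ H τ k in
    proj₁ (splitAtSuffix hs L) ++ proj₂ (splitAtSuffix hs L) ≡ L →
    Placed (proj₁ (splitAtSuffix hs L)) (proj₂ (splitAtSuffix hs L)) (insert σ τ k L)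
  insert-placed L sym-L size glue with splitAtSuffix (H σ k ++ H τ k) L
  insert-placed L sym-L size refl | C , C* with ℕ.<-cmp (length C*) (toℕ k)
  ... | tri< c<k _ _ = subst (λ X → Placed X C* (around (neg k) A M C*)) A++M≡C
    (neg-pos A M C* (proj₁ pal) (proj₂ pal)
      (inj₁ (proj₁ ne , ∈.∈-++⁺ʳ A (proj₂ ne) , ∈.∈-++⁺ʳ A (∈-rev⁻ M (proj₁ pal) (proj₂ ne)))))
    where
    c = length C*
    A = take c C
    M = drop c C
    A++M≡C : A ++ M ≡ C
    A++M≡C = List.take++drop≡id c C
    -- Otherwise L would have fewer than 2 (toℕ k) letters.
    c<∣C∣ : c < length C
    c<∣C∣ = ℕ.≰⇒> λ ∣C∣≤c → ℕ.<⇒≢ (ℕ.+-mono-< (ℕ.≤-<-trans ∣C∣≤c c<k) c<k)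
                                  (trans (sym (List.length-++ C)) size)
    ∣A∣≡c : length A ≡ c
    ∣A∣≡c = trans (List.length-take c C) (ℕ.m≤n⇒m⊓n≡m (ℕ.<⇒≤ c<∣C∣))
    pal : rev M ≡ M × rev A ≡ C*
    pal = palindrome A M C* ∣A∣≡c (subst (λ X → rev X ≡ X)
      (trans (cong (_++ C*) (sym A++M≡C)) (List.++-assoc A M C*)) sym-L)
    ne : ∃ (_∈ M)
    ne = ∈-nonempty (subst (0 <_) (sym (List.length-drop c C)) (ℕ.m<n⇒0<n∸m c<∣C∣))
  ... | tri≈ _ c≡k _ = centre-placed C C* (trans ∣C∣≡k (sym c≡k)) sym-L
    where
    ∣C∣≡k : length C ≡ toℕ k
    ∣C∣≡k = ℕ.+-cancelʳ-≡ (length C*) (length C) (toℕ k)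
      (trans (sym (List.length-++ C)) (trans size (cong (toℕ k +_) (sym c≡k))))
  ... | tri> _ _ k<c = subst (λ X → Placed C X (around (pos k) C M B)) M++B≡C*
    (pos-neg C M B (proj₁ pal) (proj₂ pal)
      (inj₁ (proj₁ ne , ∈.∈-++⁺ˡ (proj₂ ne) , ∈.∈-++⁺ˡ (∈-rev⁻ M (proj₁ pal) (proj₂ ne)))))
    where
    d = length C* ∸ length C
    M = take d C*
    B = drop d C*
    M++B≡C* : M ++ B ≡ C*
    M++B≡C* = List.take++drop≡id d C*
    -- Otherwise L would have more than 2 (toℕ k) letters.
    ∣C∣<c : length C < length C*
    ∣C∣<c = ℕ.≰⇒> λ c≤∣C∣ → ℕ.<⇒≢ (ℕ.+-mono-< (ℕ.<-≤-trans k<c c≤∣C∣) k<c)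
                                  (sym (trans (sym (List.length-++ C)) size))
    ∣C∣≡∣B∣ : length C ≡ length B
    ∣C∣≡∣B∣ = sym (trans (List.length-drop d C*) (ℕ.m∸[m∸n]≡n (ℕ.<⇒≤ ∣C∣<c)))
    pal : rev M ≡ M × rev C ≡ B
    pal = palindrome C M B ∣C∣≡∣B∣ (subst (λ X → rev X ≡ X) (cong (C ++_) (sym M++B≡C*)) sym-L)
    ∣M∣≡d : length M ≡ d
    ∣M∣≡d = trans (List.length-take d C*) (ℕ.m≤n⇒m⊓n≡m (ℕ.m∸n≤m (length C*) (length C)))
    ne : ∃ (_∈ M)
    ne = ∈-nonempty (subst (0 <_) (sym ∣M∣≡d) (ℕ.m<n⇒0<n∸m ∣C∣<c))

  -- For a relation R invariant under the symmetry, only the pairs that involve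
  -- pos k and the pair of the two new letters have to be checked.
  placed-AllPairs : {R : [± n ] → [± n ] → Set} → (∀ a b → R a b → R (‾ b) (‾ a)) →
    ∀ {C C* π′} → Placed C C* π′ → AllPairs R (C ++ C*) →
    (∀ {x} → x ∈ C → R x (pos k)) → (∀ {y} → y ∈ C* → R (pos k) y) →
    (DoublyIn C* ⊎ ¬ BothPositive → R (pos k) (neg k)) →
    (DoublyIn C ⊎ BothPositive → R (neg k) (pos k)) →
    AllPairs R π′
  placed-AllPairs {R} R-‾ (pos-neg A M B revM revA why) Rs <k k< pos<neg _ =
    AllPairs-around (pos k) A M B Rs <k k< <‾k ‾k< (pos<neg why)
    where
    <‾k : ∀ {x} → x ∈ A ++ M → R x (neg k)
    <‾k {x} x∈ = subst (λ a → R a (neg k)) (‾-involutive x)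
      (R-‾ (pos k) (‾ x) (k< (‾x∈ (∈.∈-++⁻ A x∈))))
      where
      ‾x∈ : x ∈ A ⊎ x ∈ M → ‾ x ∈ M ++ B
      ‾x∈ (inj₁ x∈A) = ∈.∈-++⁺ʳ M (subst (‾ x ∈_) revA (∈-rev x∈A))
      ‾x∈ (inj₂ x∈M) = ∈.∈-++⁺ˡ (∈-rev⁻ M revM x∈M)
    ‾k< : ∀ {y} → y ∈ B → R (neg k) y
    ‾k< {y} y∈ = subst (R (neg k)) (‾-involutive y)
      (R-‾ (‾ y) (pos k) (<k (∈-rev⁻ A revA y∈)))
  placed-AllPairs {R} R-‾ (neg-pos A M B revM revA why) Rs <k k< _ neg<pos =
    AllPairs-around (neg k) A M B (subst (AllPairs R) (List.++-assoc A M B) Rs)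
      <‾k ‾k< <k k< (neg<pos why)
    where
    <‾k : ∀ {x} → x ∈ A → R x (neg k)
    <‾k {x} x∈ = subst (λ a → R a (neg k)) (‾-involutive x)
      (R-‾ (pos k) (‾ x) (k< (subst (‾ x ∈_) revA (∈-rev x∈))))
    ‾k< : ∀ {y} → y ∈ M ++ B → R (neg k) y
    ‾k< {y} y∈ = subst (R (neg k)) (‾-involutive y)
      (R-‾ (‾ y) (pos k) (<k (‾y∈ (∈.∈-++⁻ M y∈))))
      where
      ‾y∈ : y ∈ M ⊎ y ∈ B → ‾ y ∈ A ++ M
      ‾y∈ (inj₁ y∈M) = ∈.∈-++⁺ʳ A (∈-rev⁻ M revM y∈M)
      ‾y∈ (inj₂ y∈B) = ∈.∈-++⁺ˡ (∈-rev⁻ A revA y∈B)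

-- Shortest suffixes

module _ {n : ℕ} where

  open DecSubset (_≟±_ {n}) using (_⊆?_)

  split-glue : ∀ hs (L : List [± n ]) →
    proj₁ (splitAtSuffix hs L) ++ proj₂ (splitAtSuffix hs L) ≡ L
  split-glue hs []       = refl
  split-glue hs (x ∷ xs) with hs ⊆? xs
  ... | yes _ = cong (x ∷_) (split-glue hs xs)
  ... | no _  = refl

  split-covers : ∀ hs (L : List [± n ]) → hs ⊆ L → hs ⊆ proj₂ (splitAtSuffix hs L)
  split-covers hs []       hs⊆ = hs⊆
  split-covers hs (x ∷ xs) hs⊆ with hs ⊆? xs
  ... | yes hs⊆xs = split-covers hs xs hs⊆xs
  ... | no _      = hs⊆

  -- C* being shortest, its first letter, if any, is in hs.
  split-head : ∀ hs (L : List [± n ]) → hs ⊆ L →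
               Maybe.All (_∈ hs) (head (proj₂ (splitAtSuffix hs L)))
  split-head hs []       hs⊆ = Maybe.nothing
  split-head hs (x ∷ xs) hs⊆ with hs ⊆? xs
  ... | yes hs⊆xs = split-head hs xs hs⊆xs
  ... | no hs⊈xs with Any.any? (x ≟±_) hs
  ...   | yes x∈hs = Maybe.just x∈hs
  ...   | no x∉hs  = contradiction (λ {a} (a∈hs : a ∈ hs) → tail a∈hs (hs⊆ a∈hs)) hs⊈xs
    where
    tail : ∀ {a} → a ∈ hs → a ∈ x ∷ xs → a ∈ xs
    tail a∈hs (here refl)  = contradiction a∈hs x∉hs
    tail a∈hs (there a∈xs) = a∈xs

-- Invariants of the stages of the algorithm

-- Conditions on two letters a, b of which a precedes b in a string.  Keeps σ: if
-- they are not inverted in the string, they are not inverted in σ either.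
-- Forced ρ: if they are inverted in the string, they are inverted in ρ.
Keeps Forced : SignedPerm n → [± n ] → [± n ] → Set
Keeps  σ a b = a <± b → σ ⊢ a ≺ b
Forced ρ a b = b <± a → ρ ⊢ a ≺ b

‾-anti⁻ : (a b : [± n ]) → ‾ b <± ‾ a → a <± b
‾-anti⁻ a b lt = subst₂ _<±_ (‾-involutive a) (‾-involutive b) (‾-anti (‾ b) (‾ a) lt)

Keeps-‾ : (σ : SignedPerm n) (a b : [± n ]) → Keeps σ a b → Keeps σ (‾ b) (‾ a)
Keeps-‾ σ a b keeps lt = ≺-‾ σ a b (keeps (‾-anti⁻ a b lt))

Forced-‾ : (ρ : SignedPerm n) (a b : [± n ]) → Forced ρ a b → Forced ρ (‾ b) (‾ a)
Forced-‾ ρ a b forced lt = ≺-‾ ρ a b (forced (‾-anti⁻ b a lt))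

positive⇒≺ : (σ : SignedPerm n) (k : Fin n) → Positive (from σ (pos k)) → σ ⊢ neg k ≺ pos k
positive⇒≺ σ k p = subst (_<± from σ (pos k)) (sym (from-odd σ (pos k)))
  (‾< (from σ (pos k)) p)
  where
  ‾< : (a : [± n ]) → Positive a → ‾ a <± a
  ‾< (Sign.+ , _) _ = ℤ.-<+

nonpositive⇒≻ : (σ : SignedPerm n) (k : Fin n) → ¬ Positive (from σ (pos k)) → σ ⊢ pos k ≺ neg k
nonpositive⇒≻ σ k ¬p = subst (from σ (pos k) <±_) (sym (from-odd σ (pos k)))
  (<‾ (from σ (pos k)) ¬p)
  where
  <‾ : (a : [± n ]) → ¬ Positive a → a <± ‾ a
  <‾ (Sign.+ , _) ¬p = contradiction (ℤ.+<+ (s≤s z≤n)) ¬p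
  <‾ (Sign.- , _) _  = ℤ.-<+

module _ {n : ℕ} (σ : SignedPerm n) (k : Fin n) where

  ∈-H⁺ : ∀ {a} → ∣ a ∣ < ∣ pos k ∣ → σ ⊢ pos k ≺ a → a ∈ H σ k
  ∈-H⁺ {a} lt k≺a = ∈.∈-filter⁺
    (λ a → (∣ a ∣ ℕ.<? ∣ pos k ∣) ×-dec (from σ (pos k) <±? from σ a))
    (∈-ascending a) (lt , k≺a)

  ∈-H⁻ : ∀ {a} → a ∈ H σ k → ∣ a ∣ < ∣ pos k ∣ × σ ⊢ pos k ≺ a
  ∈-H⁻ a∈ = proj₂ (∈.∈-filter⁻
    (λ a → (∣ a ∣ ℕ.<? ∣ pos k ∣) ×-dec (from σ (pos k) <±? from σ a))
    {xs = ascending n} a∈)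

-- L arranges the letters of absolute value at most m symmetrically; it inverts
-- every inversion of σ and τ among these letters, and only pairs that are
-- inverted in every upper bound ρ of σ and τ.
record Stage {n : ℕ} (σ τ : SignedPerm n) (m : ℕ) (L : List [± n ]) : Set where
  field
    symmetric : rev L ≡ L
    size      : length L ≡ m + m
    bounded   : All (λ a → ∣ a ∣ ≤ m) L
    full      : ∀ a → ∣ a ∣ ≤ m → a ∈ L
    distinct  : Unique L
    keeps-σ   : AllPairs (Keeps σ) L
    keeps-τ   : AllPairs (Keeps τ) L
    forced    : ∀ ρ → σ ⊑ ρ → τ ⊑ ρ → AllPairs (Forced ρ) L

module _ {n : ℕ} {σ τ : SignedPerm n} (k : Fin n) {C C* : List [± n ]}
         (stage : Stage σ τ (toℕ k) (C ++ C*))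
         (covers : H σ k ++ H τ k ⊆ C*)
         (starts : Maybe.All (_∈ H σ k ++ H τ k) (head C*)) where

  open Stage stage

  private
    small : ∀ {a} → a ∈ C ++ C* → ∣ a ∣ < ∣ pos k ∣
    small a∈ = s≤s (All.lookup bounded a∈)

    below : ∀ {a} → a ∈ C ++ C* → a <± pos k
    below {a} a∈ = ∣∣<⇒<pos a k (small a∈)

    inC : ∀ {a} → a ∈ C → a ∈ C ++ C*
    inC = ∈.∈-++⁺ˡ

    inC* : ∀ {a} → a ∈ C* → a ∈ C ++ C*
    inC* = ∈.∈-++⁺ʳ C

    -- For υ = σ and υ = τ: a letter of C is not in C*, hence not in H υ k.
    before-k : ∀ υ → (∀ {a} → a ∈ H υ k → a ∈ C*) → ∀ {a} → a ∈ C → υ ⊢ a ≺ pos k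
    before-k υ covered {a} a∈C with ≺-cmp υ a (pos k)
    ... | tri< a≺k _ _ = a≺k
    ... | tri≈ _ refl _ = contradiction (small (inC a∈C)) (ℕ.<-irrefl refl)
    ... | tri> _ _ k≺a = contradiction refl (AllPairs-across C distinct a∈C
                           (covered (∈-H⁺ υ k (small (inC a∈C)) k≺a)))

  module _ (ρ : SignedPerm n) (σ⊑ρ : σ ⊑ ρ) (τ⊑ρ : τ ⊑ ρ) where
    private
      -- For υ = σ and υ = τ; h is the first letter of C*.  A letter a < h follows h
      -- in ρ, and a letter a > h follows h already in υ.
      after-head : ∀ υ → υ ⊑ ρ → ∀ {h} t → h ∈ H υ k →
        (∀ {a} → a ∈ h ∷ t → a <± pos k) →
        AllPairs (Keeps υ) (h ∷ t) → AllPairs (Forced ρ) (h ∷ t) →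
        ∀ {a} → a ∈ h ∷ t → ρ ⊢ pos k ≺ a
      after-head υ υ⊑ρ {h} t h∈H <k _ _ (here refl) =
        υ⊑ρ h (pos k) (<k (here refl)) (proj₂ (∈-H⁻ υ k h∈H))
      after-head υ υ⊑ρ {h} t h∈H <k (keeps ∷ _) (forced ∷ _) {a} (there a∈t) with <±-cmp a h
      ... | tri< a<h _ _ = ℤ.<-trans
        (υ⊑ρ h (pos k) (<k (here refl)) (proj₂ (∈-H⁻ υ k h∈H))) (All.lookup forced a∈t a<h)
      ... | tri≈ _ refl _ = υ⊑ρ h (pos k) (<k (here refl)) (proj₂ (∈-H⁻ υ k h∈H))
      ... | tri> _ _ h<a = υ⊑ρ a (pos k) (<k (there a∈t))
        (ℤ.<-trans (proj₂ (∈-H⁻ υ k h∈H)) (All.lookup keeps a∈t h<a))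

    -- Every letter of C*, in H or not, comes after pos k in every upper bound ρ.
    after-k : ∀ {a} → a ∈ C* → ρ ⊢ pos k ≺ a
    after-k a∈ = go C* starts (below ∘ inC*) (AllPairs-suffix C keeps-σ)
      (AllPairs-suffix C keeps-τ) (AllPairs-suffix C (forced ρ σ⊑ρ τ⊑ρ)) a∈
      where
      go : ∀ X → Maybe.All (_∈ H σ k ++ H τ k) (head X) → (∀ {a} → a ∈ X → a <± pos k) →
           AllPairs (Keeps σ) X → AllPairs (Keeps τ) X → AllPairs (Forced ρ) X →
           ∀ {a} → a ∈ X → ρ ⊢ pos k ≺ a
      go (h ∷ t) (Maybe.just h∈) <k kσ kτ fρ with ∈.∈-++⁻ (H σ k) h∈
      ... | inj₁ h∈Hσ = after-head σ σ⊑ρ t h∈Hσ <k kσ fρ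
      ... | inj₂ h∈Hτ = after-head τ τ⊑ρ t h∈Hτ <k kτ fρ

    -- If pos k is placed before neg k, then it precedes neg k in ρ.
    forced-centre : DoublyIn C* ⊎ ¬ BothPositive σ τ k → Forced ρ (pos k) (neg k)
    forced-centre (inj₁ (a , a∈ , ‾a∈)) _ = ℤ.<-trans (after-k a∈)
      (subst (λ b → ρ ⊢ b ≺ neg k) (‾-involutive a) (≺-‾ ρ (pos k) (‾ a) (after-k ‾a∈)))
    forced-centre (inj₂ ¬both) _
      with positive? (from σ (pos k)) | positive? (from τ (pos k))
    ... | no ¬p | _     = σ⊑ρ (neg k) (pos k) (neg<pos k k) (nonpositive⇒≻ σ k ¬p)
    ... | yes _ | no ¬q = τ⊑ρ (neg k) (pos k) (neg<pos k k) (nonpositive⇒≻ τ k ¬q)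
    ... | yes p | yes q = contradiction (p , q) ¬both

  -- If neg k is placed before pos k, then it precedes pos k in σ and in τ.
  keeps-centre : ∀ υ → (∀ {a} → a ∈ H υ k → a ∈ C*) →
    (BothPositive σ τ k → Positive (from υ (pos k))) →
    DoublyIn C ⊎ BothPositive σ τ k → Keeps υ (neg k) (pos k)
  keeps-centre υ covered _ (inj₁ (a , a∈ , ‾a∈)) _ = ℤ.<-trans
    (subst (λ b → υ ⊢ neg k ≺ b) (‾-involutive a) (≺-‾ υ (‾ a) (pos k) (before-k υ covered ‾a∈)))
    (before-k υ covered a∈)
  keeps-centre υ _ positive (inj₂ both) _ = positive⇒≺ υ k (positive both)

  keeps-step : ∀ υ → AllPairs (Keeps υ) (C ++ C*) → (∀ {a} → a ∈ H υ k → a ∈ C*) →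
    (BothPositive σ τ k → Positive (from υ (pos k))) →
    ∀ {L′} → Placed σ τ k C C* L′ → AllPairs (Keeps υ) L′
  keeps-step υ keeps covered positive placed = placed-AllPairs σ τ k (Keeps-‾ υ) placed keeps
    (λ x∈ _ → before-k υ covered x∈)
    (λ y∈ k<y → contradiction k<y (ℤ.<-asym (below (inC* y∈))))
    (λ _ k<‾k → contradiction k<‾k (ℤ.<-asym (neg<pos k k)))
    (keeps-centre υ covered positive)

  -- The common shape of the two cases, for the properties that do not depend on
  -- the order of the two new letters.
  placed-around : ∀ {L′} → Placed σ τ k C C* L′ →
    ∃₂ λ e A → ∃₂ λ M B → (e ≡ pos k ⊎ e ≡ neg k) × rev M ≡ M × rev A ≡ B ×
      C ++ C* ≡ A ++ M ++ B × L′ ≡ around e A M B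
  placed-around (pos-neg A M B revM revA _) =
    pos k , A , M , B , inj₁ refl , revM , revA , refl , refl
  placed-around (neg-pos A M B revM revA _) =
    neg k , A , M , B , inj₂ refl , revM , revA , List.++-assoc A M B , refl

  stage-step : ∀ {L′} → Placed σ τ k C C* L′ → Stage σ τ (suc (toℕ k)) L′
  stage-step placed with placed-around placed
  ... | e , A , M , B , e≡±k , revM , revA , glue , refl = record
    { symmetric = rev-around e A M B revM revA
    ; size      = trans (length-around e A M B) (cong suc
        (trans (cong suc (trans (cong length (sym glue)) size)) (sym (ℕ.+-suc (toℕ k) (toℕ k)))))
    ; bounded   = All-around e A M B (e-bounded e≡±k) (e-bounded e≡±k)
        (subst (All _) glue (All.map ℕ.m≤n⇒m≤1+n bounded))
    ; full      = full′
    ; distinct  = placed-AllPairs σ τ k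
        (λ a b a≢b eq → a≢b (‾-injective (sym eq))) placed distinct
        (λ x∈ → λ { refl → ℕ.<-irrefl refl (small (inC x∈)) })
        (λ y∈ → λ { refl → ℕ.<-irrefl refl (small (inC* y∈)) })
        (λ _ ()) (λ _ ())
    ; keeps-σ   = keeps-step σ keeps-σ (covers ∘ ∈.∈-++⁺ˡ) proj₁ placed
    ; keeps-τ   = keeps-step τ keeps-τ (covers ∘ ∈.∈-++⁺ʳ (H σ k)) proj₂ placed
    ; forced    = λ ρ σ⊑ρ τ⊑ρ → placed-AllPairs σ τ k (Forced-‾ ρ) placed (forced ρ σ⊑ρ τ⊑ρ)
        (λ x∈ k<x → contradiction k<x (ℤ.<-asym (below (inC x∈))))
        (λ y∈ _ → after-k ρ σ⊑ρ τ⊑ρ y∈)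
        (forced-centre ρ σ⊑ρ τ⊑ρ)
        (λ _ k<‾k → contradiction k<‾k (ℤ.<-asym (neg<pos k k)))
    }
    where
    ‾-injective : {a b : [± n ]} → ‾ a ≡ ‾ b → a ≡ b
    ‾-injective {b = b} eq = trans (‾-swap eq) (‾-involutive b)

    e-bounded : ∀ {e} → e ≡ pos k ⊎ e ≡ neg k → ∣ e ∣ ≤ suc (toℕ k)
    e-bounded (inj₁ refl) = ℕ.≤-refl
    e-bounded (inj₂ refl) = ℕ.≤-refl

    new : ∀ {e} → e ≡ pos k ⊎ e ≡ neg k → ∀ a → ∣ a ∣ ≡ suc (toℕ k) → a ∈ around e A M B
    new {e} e≡±k (sgn , j) eq with Fin.toℕ-injective (ℕ.suc-injective eq)
    new (inj₁ refl) (Sign.+ , j) eq | refl = e∈around (pos k) A M B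
    new (inj₁ refl) (Sign.- , j) eq | refl = ‾e∈around (pos k) A M B
    new (inj₂ refl) (Sign.+ , j) eq | refl = ‾e∈around (neg k) A M B
    new (inj₂ refl) (Sign.- , j) eq | refl = e∈around (neg k) A M B

    full′ : ∀ a → ∣ a ∣ ≤ suc (toℕ k) → a ∈ around e A M B
    full′ a a≤ with ℕ.m≤n⇒m<n∨m≡n a≤
    ... | inj₁ (s≤s a<) = ∈-around e A M B (subst (a ∈_) glue (full a a<))
    ... | inj₂ a≡       = new e≡±k a a≡

module _ {n : ℕ} (σ τ : SignedPerm n) where

  stage-zero : Stage σ τ 0 []
  stage-zero = record
    { symmetric = refl ; size = refl ; bounded = [] ; full = λ _ () ; distinct = []
    ; keeps-σ = [] ; keeps-τ = [] ; forced = λ _ _ _ → [] }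

  H⊆ : ∀ k {L} → Stage σ τ (toℕ k) L → H σ k ++ H τ k ⊆ L
  H⊆ k stage {a} a∈ with ∈.∈-++⁻ (H σ k) a∈
  ... | inj₁ a∈σ = Stage.full stage a (ℕ.≤-pred (proj₁ (∈-H⁻ σ k a∈σ)))
  ... | inj₂ a∈τ = Stage.full stage a (ℕ.≤-pred (proj₁ (∈-H⁻ τ k a∈τ)))

  insert-stage : ∀ k L {m} → toℕ k ≡ m → Stage σ τ m L →
                 Stage σ τ (suc m) (insert σ τ k L)
  insert-stage k L refl stage = stage-step k
    (subst (Stage σ τ (toℕ k)) (sym (split-glue hs L)) stage)
    (split-covers hs L (H⊆ k stage)) (split-head hs L (H⊆ k stage))
    (insert-placed σ τ k L (Stage.symmetric stage) (Stage.size stage) (split-glue hs L))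
    where hs = H σ k ++ H τ k

  -- The first string is the symmetric placement of the letters 1 and ‾ 1 in the
  -- empty string.
  centre-stage : ∀ k {m} → toℕ k ≡ m → Stage σ τ m [] →
                 Stage σ τ (suc m) (centre σ τ k)
  centre-stage k refl stage = subst (Stage σ τ (suc (toℕ k)))
    (List.++-identityʳ (centre σ τ k))
    (stage-step k stage (H⊆ k stage) Maybe.nothing
      (centre-placed σ τ k [] [] refl refl))

  π-stage : ∀ m (m≤n : m ≤ n) → Stage σ τ m (π σ τ m m≤n)
  π-stage 0               _   = stage-zero
  π-stage 1               1≤n =
    centre-stage (fromℕ< 1≤n) (Fin.toℕ-fromℕ< 1≤n) stage-zero
  π-stage (suc m@(suc _)) m<n =
    insert-stage (fromℕ< m<n) _ (Fin.toℕ-fromℕ< m<n) (π-stage m (ℕ.<⇒≤ m<n))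

-- The signed permutation with a given complete notation

Unique⇒lookup-injective : {A : Set} {xs : List A} → Unique xs →
                          ∀ i j → lookup xs i ≡ lookup xs j → i ≡ j
Unique⇒lookup-injective (_ ∷ _)    zero    zero    _  = refl
Unique⇒lookup-injective (x∉xs ∷ _) zero    (suc j) eq =
  contradiction eq (All.lookup x∉xs (∈.∈-lookup j))
Unique⇒lookup-injective (x∉xs ∷ _) (suc i) zero    eq =
  contradiction (sym eq) (All.lookup x∉xs (∈.∈-lookup i))
Unique⇒lookup-injective (_ ∷ xs!)  (suc i) (suc j) eq =
  cong suc (Unique⇒lookup-injective xs! i j eq)

index-lookup : {A : Set} {xs : List A} → Unique xs →
               ∀ i (p : lookup xs i ∈ xs) → Any.index p ≡ i
index-lookup xs! i p = Unique⇒lookup-injective xs! (Any.index p) i (sym (Any.lookup-index p))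

map-≡⇒≗ : {A B : Set} {f g : A → B} {xs : List A} → map f xs ≡ map g xs →
          ∀ {x} → x ∈ xs → f x ≡ g x
map-≡⇒≗ eq (here refl) = List.∷-injectiveˡ eq
map-≡⇒≗ eq (there x∈)  = map-≡⇒≗ (List.∷-injectiveʳ eq) x∈

tabulate-lookup-cast : {A : Set} {m : ℕ} (xs : List A) (eq : m ≡ length xs) →
                       tabulate (lookup xs ∘ Fin.cast eq) ≡ xs
tabulate-lookup-cast xs refl =
  trans (List.tabulate-cong (cong (lookup xs) ∘ Fin.cast-is-id refl)) (List.tabulate-lookup xs)

length-ascending : (n : ℕ) → length (ascending n) ≡ n + n
length-ascending n = trans (List.length-++ (map neg (reverse (allFin n)))) (cong₂ _+_
  (trans (List.length-map neg (reverse (allFin n)))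
    (trans (List.length-reverse (allFin n)) (List.length-tabulate {n = n} id)))
  (trans (List.length-map pos (allFin n)) (List.length-tabulate {n = n} id)))

rev-ascending : (n : ℕ) → rev (ascending n) ≡ ascending n
rev-ascending n = begin
  rev (map neg (reverse (allFin n)) ++ map pos (allFin n))
    ≡⟨ rev-++ (map neg (reverse (allFin n))) (map pos (allFin n)) ⟩
  reverse (map ‾_ (map pos (allFin n))) ++ reverse (map ‾_ (map neg (reverse (allFin n))))
    ≡⟨ cong₂ (λ X Y → reverse X ++ reverse Y)
         (List.map-∘ (allFin n)) (List.map-∘ (reverse (allFin n))) ⟨
  reverse (map neg (allFin n)) ++ reverse (map pos (reverse (allFin n)))
    ≡⟨ cong₂ _++_ (sym (List.reverse-map neg (allFin n)))
         (trans (sym (List.reverse-map pos (reverse (allFin n))))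
                (cong (map pos) (List.reverse-involutive (allFin n)))) ⟩
  map neg (reverse (allFin n)) ++ map pos (allFin n) ∎
  where open ≡-Reasoning

-- Conjugating f by negation turns its list of values into rev of that list.
rev-map : (f : [± n ] → [± n ]) (xs : List [± n ]) →
          map (‾_ ∘ f ∘ ‾_) (rev xs) ≡ rev (map f xs)
rev-map f xs = begin
  map (‾_ ∘ f ∘ ‾_) (reverse (map ‾_ xs))   ≡⟨ List.reverse-map _ (map ‾_ xs) ⟩
  reverse (map (‾_ ∘ f ∘ ‾_) (map ‾_ xs))   ≡⟨ cong reverse (List.map-∘ xs) ⟨
  reverse (map (‾_ ∘ f ∘ ‾_ ∘ ‾_) xs)
    ≡⟨ cong reverse (List.map-cong (cong (‾_ ∘ f) ∘ ‾-involutive) xs) ⟩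
  reverse (map (‾_ ∘ f) xs)                 ≡⟨ cong reverse (List.map-∘ xs) ⟩
  reverse (map ‾_ (map f xs))               ∎
  where open ≡-Reasoning

module _ {n : ℕ} (L : List [± n ]) (sym-L : rev L ≡ L) (size : length L ≡ n + n)
         (full : ∀ a → a ∈ L) (distinct : Unique L) where

  private
    ∣asc∣≡∣L∣ : length (ascending n) ≡ length L
    ∣asc∣≡∣L∣ = trans (length-ascending n) (sym size)

    -- With the places of L labelled by the letters in ascending order, value a is
    -- the entry of L at the place labelled a, and place b labels the entry b.
    value place : [± n ] → [± n ]
    value a = lookup L (Fin.cast ∣asc∣≡∣L∣ (Any.index (∈-ascending a)))
    place b = lookup (ascending n) (Fin.cast (sym ∣asc∣≡∣L∣) (Any.index (full b)))

    value-place : ∀ b → value (place b) ≡ b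
    value-place b = trans (cong (lookup L) (trans
      (cong (Fin.cast ∣asc∣≡∣L∣) (index-lookup (ascending-unique n) _ _))
      (Fin.cast-involutive ∣asc∣≡∣L∣ (sym ∣asc∣≡∣L∣) _)))
      (sym (Any.lookup-index (full b)))

    place-value : ∀ a → place (value a) ≡ a
    place-value a = trans (cong (lookup (ascending n)) (trans
      (cong (Fin.cast (sym ∣asc∣≡∣L∣)) (index-lookup distinct _ _))
      (Fin.cast-involutive (sym ∣asc∣≡∣L∣) ∣asc∣≡∣L∣ _)))
      (sym (Any.lookup-index (∈-ascending a)))

    values≡L : map value (ascending n) ≡ L
    values≡L = begin
      map value (ascending n)
        ≡⟨ cong (map value) (List.tabulate-lookup (ascending n)) ⟨
      map value (tabulate (lookup (ascending n)))
        ≡⟨ List.map-tabulate (lookup (ascending n)) value ⟩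
      tabulate (value ∘ lookup (ascending n))
        ≡⟨ List.tabulate-cong (λ i → cong (lookup L ∘ Fin.cast ∣asc∣≡∣L∣)
             (index-lookup (ascending-unique n) i _)) ⟩
      tabulate (lookup L ∘ Fin.cast ∣asc∣≡∣L∣)
        ≡⟨ tabulate-lookup-cast L ∣asc∣≡∣L∣ ⟩
      L ∎
      where open ≡-Reasoning

    -- value and its conjugate by negation have the same list of values, since L
    -- and ascending n are fixed by rev.
    value-odd : ∀ a → value (‾ a) ≡ ‾ value a
    value-odd a = ‾-swap (map-≡⇒≗ (begin
      map (‾_ ∘ value ∘ ‾_) (ascending n)
        ≡⟨ cong (map (‾_ ∘ value ∘ ‾_)) (rev-ascending n) ⟨
      map (‾_ ∘ value ∘ ‾_) (rev (ascending n))   ≡⟨ rev-map value (ascending n) ⟩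
      rev (map value (ascending n))               ≡⟨ cong rev values≡L ⟩
      rev L                                       ≡⟨ sym-L ⟩
      L                                           ≡⟨ values≡L ⟨
      map value (ascending n)                     ∎) (∈-ascending a))
      where open ≡-Reasoning

  -- A string fixed by rev that contains each letter exactly once is the complete
  -- notation of a signed permutation.
  complete-surjective : Σ[ ω ∈ SignedPerm n ] complete ω ≡ L
  complete-surjective = record
    { bijection = mk↔ₛ′ value place value-place place-value
    ; odd       = value-odd
    } , values≡L

-- A relation that holds along the complete notation holds along ≺.
AllPairs-complete : {R : [± n ] → [± n ] → Set} (ω : SignedPerm n) →
                    AllPairs R (complete ω) → ∀ a b → ω ⊢ a ≺ b → R a b
AllPairs-complete {n} {R} ω Rω a b a≺b
  with ∈.∈-AllPairs₂ (AllPairs.zip (AllPairs.map⁻ Rω , ascending-sorted n))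
                     (∈-ascending (from ω a)) (∈-ascending (from ω b))
... | inj₁ eq              = contradiction a≺b (<±-irrefl eq)
... | inj₂ (inj₁ (r , _))  = subst₂ R (to-from ω a) (to-from ω b) r
... | inj₂ (inj₂ (_ , gt)) = contradiction gt (ℤ.<-asym a≺b)

keeps⇒⊑ : (σ ω : SignedPerm n) → AllPairs (Keeps σ) (complete ω) → σ ⊑ ω
keeps⇒⊑ σ ω keeps a b a<b b≺a with ≺-cmp ω a b
... | tri< a≺b _ _  = contradiction b≺a (ℤ.<-asym (AllPairs-complete ω keeps a b a≺b a<b))
... | tri≈ _ refl _ = contradiction a<b (<±-irrefl {a = a} refl)
... | tri> _ _ b≺a′ = b≺a′

theorem13 : (n : ℕ) → 1 ≤ n → (σ τ : SignedPerm n) →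
    Σ[ ω ∈ SignedPerm n ] (complete ω ≡ J σ τ × IsJoin σ τ ω)
theorem13 n 1≤n σ τ = ω , ω≡J
  , ⊑⇒≤R σ ω (keeps⇒⊑ σ ω (spelled keeps-σ))
  , ⊑⇒≤R τ ω (keeps⇒⊑ τ ω (spelled keeps-τ))
  , λ ρ σ≤ρ τ≤ρ → ⊑⇒≤R ω ρ λ a b a<b b≺a → AllPairs-complete ω
      (spelled (forced ρ (≤R⇒⊑ σ ρ σ≤ρ) (≤R⇒⊑ τ ρ τ≤ρ))) b a b≺a a<b
  where
  open Stage (π-stage σ τ n ℕ.≤-refl)

  spelling : Σ[ ω ∈ SignedPerm n ] complete ω ≡ J σ τ
  spelling = complete-surjective (J σ τ) symmetric size
    (λ a → full a (Fin.toℕ<n (proj₂ a))) distinct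

  ω : SignedPerm n
  ω = proj₁ spelling

  ω≡J : complete ω ≡ J σ τ
  ω≡J = proj₂ spelling

  spelled : {R : [± n ] → [± n ] → Set} → AllPairs R (J σ τ) → AllPairs R (complete ω)
  spelled {R} = subst (AllPairs R) (sym ω≡J)
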